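{- Let $T$ be a skew tract endowed with an involution $x\mapsto\overline x$, let $N$ be a matroid on a non-empty finite set $E$, let $\mathcal{C}$ be a left $T$-signature of $N$, and let $\mathcal{D}$ be a right $T$-signature of $N^*$. Then $\mathcal{C}$ and $\mathcal{D}$ are the sets of $T$-circuits and $T$-cocircuits, respectively, of a strong left $T$-matroid with underlying matroid $N$ if and only if $(\mathcal{C},\mathcal{D})$ forms a dual pair of $T$-signatures of $N$, i.e. $\mathcal{C}\perp\mathcal{D}$.
   Context: **Skew tracts.** A skew tract $T$ is a group $G$ (written multiplicatively, identity $1$) together with a subset $N_G$ of the group semiring $\mathbb{N}[G]$ such that: (1) $0\in N_G$; (2) $1\notin N_G$; (3) there is a unique $\epsilon\in G$ with $1+\epsilon\in N_G$; (4) $N_G$ is closed under the left and right actions of $G$ on $\mathbb{N}[G]$. Write $T=G\cup\{0\}$, $T^\times=G$, where $0$ is identified with the zero of $\mathbb{N}[G]$ and is absorbing for multiplication; $-x:=\epsilon x$ (one has $\epsilon x=x\epsilon$ and $\epsilon^2=1$). An involution of $T$ is a map $x\mapsto\overline x$ from $T$ to $T$ with $\overline 0=0$, that is a monoid homomorphism $(T,\cdot,1)\to(T,\cdot,1)$, preserves addition (its additive extension to $\mathbb{N}[G]$ maps $N_G$ into $N_G$), and has square the identity. $T^E$ is the set of functions $E\to T$, with coordinatewise left and right multiplication by $T$. The support of $X\in T^E$ is $\underline{X}=\{e\in E: X(e)\neq 0\}$; for $S\subseteq T^E$, $\underline{S}$ is the set of supports of elements of $S$. **Orthogonality.** $X\perp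 Y$ means $X\cdot Y:=\sum_{e\in E}X(e)\overline{Y(e)}\in N_G$; $\mathcal{C}\perp\mathcal{D}$ means $X\perp Y$ for all $X\in\mathcal{C}$, $Y\in\mathcal{D}$. **Modular families.** For a collection $C$ of pairwise incomparable non-empty subsets of $E$, $U(C)=\{\bigcup S: S\subseteq C\}$ is a lattice under inclusion (join is union, minimal element $\emptyset$). A family of members of $C$ is modular if the height of its union in $U(C)$ equals the size of the family. A family of elements of $\mathcal{C}\subseteq T^E$ is modular if the family of supports is modular in $\underline{\mathcal{C}}$. **Strong $T$-matroids.** $\mathcal{C}\subseteq T^E$ is the $T$-circuit set of a strong left $T$-matroid $\mathcal{M}=(E,\mathcal{C})$ on $E$ if: (C1) $0\notin\mathcal{C}$; (C2) $X\in\mathcal{C}$, $\alpha\in T^\times$ imply $\alpha X\in\mathcal{C}$; (C3) if $X,Y\in\mathcal{C}$ and $\underline X\subseteq\underline Y$ then $Y=\alpha X$ for some $\alpha\in T^\times$; (C4)$'$ whenever $X_1,\dots,X_k,X\in\mathcal{C}$ together form a modular family of size $k+1$ with $\underline X\not\subseteq\bigcup_{i}\underline{X_i}$, and $e_i\in(\underline X\cap\underline{X_i})\setminus\bigcup_{j\ne i}\underline{X_j}$ satisfy $X(e_i)=-X_i(e_i)\neq0$ for $1\le i\le k$, there is $Z\in\mathcal{C}$ with $Z(e_i)=0$ for $1\le i\le k$ and $X(f)+X_1(f)+\dots+X_k(f)-Z(f)\in N_G$ for every $f\in E$. The underlying matroid $\underline{\mathcal{M}}$ is the matroid on $E$ whose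 circuits are the supports of the elements of $\mathcal{C}$. **Signatures.** A left $T$-signature of a matroid $N$ is a set $\mathcal{C}\subseteq T^E$ satisfying (C1), (C2), (C3) such that $\underline{\mathcal{C}}$ is the set of circuits of $N$. Right $T$-signatures are defined likewise with $X\alpha$ in place of $\alpha X$ in (C2), (C3). $(\mathcal{C},\mathcal{D})$ is a dual pair of $T$-signatures of $N$ if $\mathcal{C}$ is a left $T$-signature of $N$, $\mathcal{D}$ is a right $T$-signature of the dual matroid $N^*$, and $\mathcal{C}\perp\mathcal{D}$. **Cocircuits.** $A_N$ is the set of ordered pairs $(B,B')$ of bases of $N$ with $|B\setminus B'|=1$; $Fab=F\cup\{a,b\}$ etc. For a left $T$-matroid $\mathcal{M}$ with $T$-circuit set $\mathcal{C}$ and underlying matroid $N$, let $[Fa,Fb]_{\mathcal{C}}:=-X(a)^{ -1}X(b)$ for any $X\in\mathcal{C}$ with $a,b\in\underline X\subseteq Fab$ (well defined on $A_N$), and let $[B,B']^*:=-\overline{[E\setminus B,E\setminus B']_{\mathcal{C}}}$ for $(B,B')\in A_{N^*}$. The set of $T$-cocircuits of $\mathcal{M}$ is the $T$-circuit set of the dual right $T$-matroid $\mathcal{M}^*$ (the one with quasi-Plücker coordinates $[\cdot]^*$), namely $\{Y\in T^E:\underline Y$ is a circuit of $N^*$ and $Y(b)Y(a)^{ -1}=-[Fa,Fb]^*$ whenever $a,b\in\underline Y\subseteq Fab$ with $(Fa,Fb)\in A_{N^*}\}$. -}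

module Defs where

open import Level using (Level; _⊔_; 0ℓ) renaming (suc to lsuc)
open import Algebra.Bundles using (Group)
open import Algebra.Bundles.Raw using (RawMonoid)
open import Algebra.Morphism.Structures using (module MonoidMorphisms)
open import Data.Fin.Base using (Fin)
open import Data.Fin.Properties using (any?) renaming (_≟_ to _≟ᶠ_)
open import Data.Fin.Subset
open import Data.Fin.Subset.Properties
open import Data.List.Base as List using (List; []; _∷_; concatMap; fromMaybe; tabulate)
open import Data.List.Relation.Unary.All using (All)
import Data.List.Relation.Binary.Permutation.Setoid as Permutation
open import Data.Maybe.Base as Maybe using (Maybe; just; nothing; is-just)
import Data.Maybe.Relation.Binary.Pointwise as MaybePointwise
open import Data.Nat.Base as ℕ using (ℕ; suc)
open import Data.Nat.Induction using (<-wellFounded)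
open import Data.Product.Base using (Σ-syntax; ∃; ∃-syntax; _×_; _,_; proj₁; proj₂)
open import Data.Product using (∃!)
open import Data.Sum.Base using (inj₁; inj₂)
import Data.Vec.Base as Vec
import Data.Vec.Functional as F
open F using (Vector)
import Data.Vec.Functional.Relation.Binary.Equality.Setoid as VectorEquality
open import Function.Base using (_∘_)
open import Induction.WellFounded using (Acc; acc)
open import Relation.Binary.Bundles using (Setoid)
open import Relation.Binary.PropositionalEquality using (_≡_; _≢_; refl; subst)
open import Relation.Nullary using (¬_; yes; no; contradiction)
open import Relation.Nullary.Decidable using (_×-dec_; ¬?)
open import Relation.Unary using (Pred; Decidable; _≐_)

------------------------------------------------------------------------
-- Matroids on Fin n

-- A matroid on a finite set is finite data, hence the decidability of
-- being a basis.
record Matroid (n : ℕ) : Set₁ where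
  field
    IsBasis  : Pred (Subset n) 0ℓ
    isBasis? : Decidable IsBasis
    nonempty : ∃[ B ] IsBasis B
    exchange : ∀ {B B′} → IsBasis B → IsBasis B′ →
               ∀ {x} → x ∈ B → x ∉ B′ →
               ∃[ y ] y ∈ B′ × y ∉ B × IsBasis ((B - x) ∪ ⁅ y ⁆)

  Independent : Pred (Subset n) 0ℓ
  Independent I = ∃[ B ] IsBasis B × I ⊆ B

  IsCircuit : Pred (Subset n) 0ℓ
  IsCircuit S = ¬ Independent S × (∀ S′ → S′ ⊂ S → Independent S′)

  -- The set A_N of pairs of bases differing by a single exchange.
  Adjacent : Subset n → Subset n → Set
  Adjacent B B′ = IsBasis B × IsBasis B′ × ∣ B ─ B′ ∣ ≡ 1

private
  x∈p─q⇒x∉q : ∀ {n} {p q : Subset n} {x} → x ∈ p ─ q → x ∉ q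
  x∈p─q⇒x∉q {p = _ Vec.∷ _} {outside Vec.∷ _} Vec.here ()
  x∈p─q⇒x∉q {p = _ Vec.∷ _} {_ Vec.∷ _} (Vec.there x∈) (Vec.there x∈q) =
    x∈p─q⇒x∉q x∈ x∈q

  ∈-swap⁻ : ∀ {n} {p : Subset n} {x y v} → v ∈ (p - x) ∪ ⁅ y ⁆ → v ≢ y →
            v ∈ p × v ≢ x
  ∈-swap⁻ {p = p} {x} {y} v∈ v≢y with x∈p∪q⁻ (p - x) ⁅ y ⁆ v∈
  ... | inj₁ v∈p-x = p─q⊆p p ⁅ x ⁆ v∈p-x , λ { refl → x∈p─q⇒x∉q v∈p-x (x∈⁅x⁆ x) }
  ... | inj₂ v∈⁅y⁆ = contradiction (x∈⁅y⁆⇒x≡y y v∈⁅y⁆) v≢y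

  ∈-swap⁺ : ∀ {n} {p : Subset n} {x y v} → v ∈ p → v ≢ x → v ∈ (p - x) ∪ ⁅ y ⁆
  ∈-swap⁺ v∈p v≢x = x∈p∪q⁺ (inj₁ (x∈p∧x≢y⇒x∈p-y v∈p v≢x))

  y∈swap : ∀ {n} {p : Subset n} {x y} → y ∈ (p - x) ∪ ⁅ y ⁆
  y∈swap {y = y} = x∈p∪q⁺ (inj₂ (x∈⁅x⁆ y))

module _ {n : ℕ} (N : Matroid n) where
  open Matroid N

  coexchange : ∀ {B B′} → IsBasis B → IsBasis B′ → ∀ {x} → x ∈ B′ → x ∉ B →
               ∃[ y ] y ∈ B × y ∉ B′ × IsBasis ((B - y) ∪ ⁅ x ⁆)
  coexchange {B} {B′} bB bB′ {x} x∈B′ x∉B =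
    go B′ (<-wellFounded _) bB′ x∈B′ (λ _ v∈B′ → v∈B′)
    where
    -- A is moved, from B′ towards B ∪ ⁅ x ⁆, through bases containing
    -- x and B ∩ B′.
    go : ∀ A → Acc ℕ._<_ ∣ A ─ (B ∪ ⁅ x ⁆) ∣ → IsBasis A → x ∈ A →
         (∀ {v} → v ∈ B → v ∈ B′ → v ∈ A) →
         ∃[ y ] y ∈ B × y ∉ B′ × IsBasis ((B - y) ∪ ⁅ x ⁆)
    go A (acc rs) bA x∈A keep
      with any? (λ z → (z ∈? A) ×-dec ¬? (z ∈? (B ∪ ⁅ x ⁆)))
    ... | yes (z , z∈A , z∉S) with exchange bA bB z∈A (z∉S ∘ x∈p∪q⁺ ∘ inj₁)
    ...   | w , w∈B , w∉A , bA′ =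
      go A′ (rs (p⊂q⇒∣p∣<∣q∣ (shrinks , z , x∈p∧x∉q⇒x∈p─q z∈A z∉S , z∉)))
         bA′ (∈-swap⁺ x∈A (λ { refl → z∉S y∈swap′ }))
         (λ v∈B v∈B′ → ∈-swap⁺ (keep v∈B v∈B′)
                         (λ { refl → z∉S (x∈p∪q⁺ (inj₁ v∈B)) }))
      where
      A′ = (A - z) ∪ ⁅ w ⁆
      y∈swap′ : x ∈ B ∪ ⁅ x ⁆
      y∈swap′ = x∈p∪q⁺ (inj₂ (x∈⁅x⁆ x))
      shrinks : A′ ─ (B ∪ ⁅ x ⁆) ⊆ A ─ (B ∪ ⁅ x ⁆)
      shrinks v∈ = x∈p∧x∉q⇒x∈p─q
        (proj₁ (∈-swap⁻ (p─q⊆p A′ _ v∈)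
                 (λ { refl → x∈p─q⇒x∉q v∈ (x∈p∪q⁺ (inj₁ w∈B)) })))
        (x∈p─q⇒x∉q v∈)
      z∉ : z ∉ A′ ─ (B ∪ ⁅ x ⁆)
      z∉ z∈ = proj₂ (∈-swap⁻ {p = A} {x = z} (p─q⊆p A′ _ z∈)
                      (λ { refl → w∉A z∈A })) refl
    go A _ bA x∈A keep | no A⊆S with exchange bA bB x∈A x∉B
    ... | y , y∈B , y∉A , bA′ =
      y , y∈B , (λ y∈B′ → y∉A (keep y∈B y∈B′)) ,
      subst IsBasis (⊆-antisym to from) bA
      where
      to : A ⊆ (B - y) ∪ ⁅ x ⁆
      to {v} v∈A with v ∈? B
      ... | yes v∈B = ∈-swap⁺ v∈B (λ { refl → y∉A v∈A })
      ... | no v∉B with v ≟ᶠ x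
      ...   | yes refl = y∈swap
      ...   | no v≢x = contradiction (v , v∈A , v∉S) A⊆S
        where
        v∉S : v ∉ B ∪ ⁅ x ⁆
        v∉S v∈ with x∈p∪q⁻ B ⁅ x ⁆ v∈
        ... | inj₁ v∈B = v∉B v∈B
        ... | inj₂ v∈x = v≢x (x∈⁅y⁆⇒x≡y x v∈x)

      A′⊆B : (A - x) ∪ ⁅ y ⁆ ⊆ B
      A′⊆B {v} v∈ with v ≟ᶠ y
      ... | yes refl = y∈B
      ... | no v≢y with ∈-swap⁻ v∈ v≢y
      ...   | v∈A , v≢x with x∈p∪q⁻ (B - y) ⁅ x ⁆ (to v∈A)
      ...     | inj₁ v∈B-y = p─q⊆p B _ v∈B-y
      ...     | inj₂ v∈x   = contradiction (x∈⁅y⁆⇒x≡y x v∈x) v≢x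

      B⊆A′ : B ⊆ (A - x) ∪ ⁅ y ⁆
      B⊆A′ {v} v∈B with v ∈? ((A - x) ∪ ⁅ y ⁆)
      ... | yes v∈ = v∈
      ... | no v∉ with exchange bB bA′ v∈B v∉
      ...   | w , w∈A′ , w∉B , _ = contradiction (A′⊆B w∈A′) w∉B

      from : (B - y) ∪ ⁅ x ⁆ ⊆ A
      from {v} v∈ with v ≟ᶠ x
      ... | yes refl = x∈A
      ... | no v≢x with ∈-swap⁻ v∈ v≢x
      ...   | v∈B , v≢y = proj₁ (∈-swap⁻ (B⊆A′ v∈B) v≢y)

  dual : Matroid n
  dual = record
    { IsBasis  = IsBasis ∘ ∁
    ; isBasis? = isBasis? ∘ ∁
    ; nonempty = let (B , bB) = nonempty in
                 ∁ B , subst IsBasis (⊆-antisym (x∉p⇒x∈∁p ∘ x∈p⇒x∉∁p)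
                                                (x∉∁p⇒x∈p ∘ x∈∁p⇒x∉p)) bB
    ; exchange = λ bB bB′ x∈B x∉B′ →
        let (y , y∈ , y∉ , b) = coexchange bB bB′ (x∉p⇒x∈∁p x∉B′) (x∈p⇒x∉∁p x∈B)
        in y , x∉∁p⇒x∈p y∉ , x∈∁p⇒x∉p y∈ ,
           subst IsBasis (swap-∁ x∈B (x∈∁p⇒x∉p y∈)) b
    }
    where
    swap-∁ : ∀ {B x y} → x ∈ B → y ∉ B →
             (∁ B - y) ∪ ⁅ x ⁆ ≡ ∁ ((B - x) ∪ ⁅ y ⁆)
    swap-∁ {B} {x} {y} x∈B y∉B = ⊆-antisym to from
      where
      to : (∁ B - y) ∪ ⁅ x ⁆ ⊆ ∁ ((B - x) ∪ ⁅ y ⁆)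
      to {v} v∈ with v ≟ᶠ x
      ... | yes refl = x∉p⇒x∈∁p λ v∈′ →
              proj₂ (∈-swap⁻ {p = B} {x = x} v∈′ (λ { refl → y∉B x∈B })) refl
      ... | no v≢x with ∈-swap⁻ v∈ v≢x
      ...   | v∈∁B , v≢y = x∉p⇒x∈∁p λ v∈′ →
              x∈∁p⇒x∉p v∈∁B (proj₁ (∈-swap⁻ {x = x} v∈′ v≢y))
      from : ∁ ((B - x) ∪ ⁅ y ⁆) ⊆ (∁ B - y) ∪ ⁅ x ⁆
      from {v} v∈ with v ≟ᶠ x
      ... | yes refl = y∈swap
      ... | no v≢x = ∈-swap⁺
              (x∉p⇒x∈∁p λ v∈B → x∈∁p⇒x∉p v∈ (∈-swap⁺ v∈B v≢x))
              (λ { refl → x∈∁p⇒x∉p v∈ y∈swap })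

------------------------------------------------------------------------
-- Modular families

module _ {n : ℕ} {s : Level} (𝒮 : Pred (Subset n) s) where

  -- The lattice U(𝒮).
  Unions : Pred (Subset n) s
  Unions A = ∃[ L ] All 𝒮 L × ⋃ L ≡ A

  -- Chains ⊥ ⊂ ⋯ ⊂ A in U(𝒮), indexed by their number of strict steps.
  data Chain : Subset n → ℕ → Set s where
    bottom : Chain ⊥ 0
    step   : ∀ {A B h} → Chain A h → Unions B → A ⊂ B → Chain B (suc h)

  HasHeight : Subset n → ℕ → Set s
  HasHeight A h = Chain A h × (∀ h′ → Chain A h′ → h′ ℕ.≤ h)

  -- A family indexed by Fin m has size m.
  Modular : ∀ {m} → Vector (Subset n) m → Set s
  Modular {m} S = (∀ i → 𝒮 (S i)) × HasHeight (⋃ (tabulate S)) m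

------------------------------------------------------------------------
-- Skew tracts

-- The additive monoid ℕ[G] is the free commutative monoid on G, so its
-- elements are finite lists of group elements up to permutation: the
-- list x₁ ∷ … ∷ xₖ ∷ [] stands for x₁ + ⋯ + xₖ.
record SkewTract (c ℓ p : Level) : Set (lsuc (c ⊔ ℓ ⊔ p)) where
  field
    group : Group c ℓ

  open Group group public
    renaming (Carrier to G; _∙_ to _∙ᴳ_; ε to 1ᴳ; _⁻¹ to _⁻¹ᴳ; _≈_ to _≈ᴳ_;
              setoid to setoidᴳ)
    using ()

  ℕ[G] : Set c
  ℕ[G] = List G

  open Permutation setoidᴳ public using (_↭_)

  field
    Null       : Pred ℕ[G] p
    Null-resp  : ∀ {s t} → s ↭ t → Null s → Null t
    Null-0     : Null []
    ¬Null-1    : ¬ Null (1ᴳ ∷ [])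
    negation   : ∃! _≈ᴳ_ λ ϵ → Null (1ᴳ ∷ ϵ ∷ [])
    Null-left  : ∀ g {s} → Null s → Null (List.map (g ∙ᴳ_) s)
    Null-right : ∀ g {s} → Null s → Null (List.map (_∙ᴳ g) s)

  ϵ : G
  ϵ = proj₁ negation

  -- T = G ∪ {0}, with 0 represented by nothing.
  T : Set c
  T = Maybe G

  T-setoid : Setoid c (c ⊔ ℓ)
  T-setoid = MaybePointwise.setoid setoidᴳ

  open Setoid T-setoid public using () renaming (_≈_ to _≈ᵀ_)

  0ᵀ 1ᵀ : T
  0ᵀ = nothing
  1ᵀ = just 1ᴳ

  infixl 7 _∙ᵀ_
  _∙ᵀ_ : T → T → T
  _∙ᵀ_ = Maybe.zipWith _∙ᴳ_

  infix 8 -ᵀ_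
  -ᵀ_ : T → T
  -ᵀ x = just ϵ ∙ᵀ x

  -- Meant for nonzero arguments only; the value at 0 is 0.
  infix 9 _⁻¹ᵀ
  _⁻¹ᵀ : T → T
  _⁻¹ᵀ = Maybe.map _⁻¹ᴳ

  T-rawMonoid : RawMonoid c (c ⊔ ℓ)
  T-rawMonoid = record { _≈_ = _≈ᵀ_ ; _∙_ = _∙ᵀ_ ; ε = 1ᵀ }

  sum : List T → ℕ[G]
  sum = concatMap fromMaybe

record Involution {c ℓ p : Level} (𝕋 : SkewTract c ℓ p) : Set (c ⊔ ℓ ⊔ p) where
  open SkewTract 𝕋
  open MonoidMorphisms T-rawMonoid T-rawMonoid using (IsMonoidHomomorphism)
  field
    bar                  : T → T
    isMonoidHomomorphism : IsMonoidHomomorphism bar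
    bar-0                : bar 0ᵀ ≈ᵀ 0ᵀ
    bar-Null             : ∀ {s} → Null s → Null (sum (List.map (bar ∘ just) s))
    bar-involutive       : ∀ x → bar (bar x) ≈ᵀ x

------------------------------------------------------------------------
-- Signatures and strong matroids

module _ {c ℓ p : Level} (𝕋 : SkewTract c ℓ p) where
  open SkewTract 𝕋
  open VectorEquality T-setoid using (_≋_)

  support : ∀ {n} → Vector T n → Subset n
  support X = Vec.tabulate (is-just ∘ X)

  Supports : ∀ {n q} → Pred (Vector T n) q → Pred (Subset n) (c ⊔ q)
  Supports 𝒞 S = ∃[ X ] 𝒞 X × support X ≡ S

  infixr 7 _∙ˡ_
  _∙ˡ_ : ∀ {n} → T → Vector T n → Vector T n
  α ∙ˡ X = F.map (α ∙ᵀ_) X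

  infixl 7 _∙ʳ_
  _∙ʳ_ : ∀ {n} → Vector T n → T → Vector T n
  X ∙ʳ α = F.map (_∙ᵀ α) X

  -- The field resp says that 𝒞 is a subset of Tᴱ, equality in Tᴱ being
  -- pointwise equality in T.
  record LeftAxioms {n : ℕ} {q : Level} (𝒞 : Pred (Vector T n) q) :
                    Set (c ⊔ ℓ ⊔ q) where
    field
      resp : ∀ {X Y} → X ≋ Y → 𝒞 X → 𝒞 Y
      C1   : ¬ 𝒞 (F.replicate n 0ᵀ)
      C2   : ∀ {X} → 𝒞 X → ∀ (α : G) → 𝒞 (just α ∙ˡ X)
      C3   : ∀ {X Y} → 𝒞 X → 𝒞 Y → support X ⊆ support Y →
             Σ[ α ∈ G ] Y ≋ (just α ∙ˡ X)

  record RightAxioms {n : ℕ} {q : Level} (𝒟 : Pred (Vector T n) q) :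
                     Set (c ⊔ ℓ ⊔ q) where
    field
      resp : ∀ {X Y} → X ≋ Y → 𝒟 X → 𝒟 Y
      C1   : ¬ 𝒟 (F.replicate n 0ᵀ)
      C2   : ∀ {X} → 𝒟 X → ∀ (α : G) → 𝒟 (X ∙ʳ just α)
      C3   : ∀ {X Y} → 𝒟 X → 𝒟 Y → support X ⊆ support Y →
             Σ[ α ∈ G ] Y ≋ (X ∙ʳ just α)

  record LeftSignature {n : ℕ} (N : Matroid n) {q : Level}
                       (𝒞 : Pred (Vector T n) q) : Set (c ⊔ ℓ ⊔ q) where
    field
      leftAxioms : LeftAxioms 𝒞
      supports   : Supports 𝒞 ≐ Matroid.IsCircuit N

  record RightSignature {n : ℕ} (N : Matroid n) {q : Level}
                        (𝒟 : Pred (Vector T n) q) : Set (c ⊔ ℓ ⊔ q) where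
    field
      rightAxioms : RightAxioms 𝒟
      supports    : Supports 𝒟 ≐ Matroid.IsCircuit N

  record StrongLeftMatroid (n : ℕ) (q : Level) : Set (c ⊔ ℓ ⊔ p ⊔ lsuc q) where
    field
      Circuits   : Pred (Vector T n) q
      leftAxioms : LeftAxioms Circuits
      C4′        : ∀ {k} (Xs : Vector (Vector T n) k) (X : Vector T n) →
                   (∀ i → Circuits (Xs i)) → Circuits X →
                   Modular (Supports Circuits) (F.map support (X F.∷ Xs)) →
                   ¬ (support X ⊆ ⋃ (tabulate (support ∘ Xs))) →
                   (e : Fin k → Fin n) →
                   (∀ i → e i ∈ support X ∩ support (Xs i)) →
                   (∀ i j → j ≢ i → e i ∉ support (Xs j)) →
                   (∀ i → X (e i) ≈ᵀ -ᵀ Xs i (e i)) →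
                   Σ[ Z ∈ Vector T n ] Circuits Z ×
                     (∀ i → Z (e i) ≈ᵀ 0ᵀ) ×
                     (∀ f → Null (sum (X f ∷ (-ᵀ Z f) ∷ tabulate (λ i → Xs i f))))

  IsUnderlying : ∀ {n q} → StrongLeftMatroid n q → Matroid n → Set (c ⊔ q)
  IsUnderlying M N = Supports (StrongLeftMatroid.Circuits M) ≐ Matroid.IsCircuit N

  ----------------------------------------------------------------------
  -- Orthogonality, dual pairs and cocircuits

  module _ (inv : Involution 𝕋) where
    open Involution inv using (bar)

    infix 7 _·_
    _·_ : ∀ {n} → Vector T n → Vector T n → ℕ[G]
    X · Y = sum (tabulate λ e → X e ∙ᵀ bar (Y e))

    Orthogonal : ∀ {n q r} → Pred (Vector T n) q → Pred (Vector T n) r →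
                 Set (c ⊔ p ⊔ q ⊔ r)
    Orthogonal 𝒞 𝒟 = ∀ {X Y} → 𝒞 X → 𝒟 Y → Null (X · Y)

    record DualPair {n : ℕ} (N : Matroid n) {q r : Level}
                    (𝒞 : Pred (Vector T n) q) (𝒟 : Pred (Vector T n) r) :
                    Set (c ⊔ ℓ ⊔ p ⊔ q ⊔ r) where
      field
        leftSignature  : LeftSignature N 𝒞
        rightSignature : RightSignature (dual N) 𝒟
        orthogonal     : Orthogonal 𝒞 𝒟

    module _ {n : ℕ} {q : Level} (M : StrongLeftMatroid n q) (N : Matroid n) where
      open StrongLeftMatroid M using (Circuits)

      -- Below N is meant to be the matroid underlying M. Quasi-Plücker
      -- coordinates are partial functions, given by their graphs:
      -- Coordinate B B′ x says that [B , B′] is defined and equal to x.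
      -- Adjacency forces a and b to be the elements of B ─ B′ and B′ ─ B
      -- and F to be B ∩ B′.
      Coordinate : Subset n → Subset n → T → Set (c ⊔ ℓ ⊔ q)
      Coordinate B B′ x =
        Matroid.Adjacent N B B′ ×
        (∃[ F ] ∃[ a ] ∃[ b ] B ≡ F ∪ ⁅ a ⁆ × B′ ≡ F ∪ ⁅ b ⁆ ×
          (∃[ X ] Circuits X × a ∈ support X × b ∈ support X ×
                  support X ⊆ F ∪ ⁅ a ⁆ ∪ ⁅ b ⁆ ×
                  x ≈ᵀ -ᵀ (X a ⁻¹ᵀ ∙ᵀ X b)))

      Coordinate* : Subset n → Subset n → T → Set (c ⊔ ℓ ⊔ q)
      Coordinate* B B′ y =
        Matroid.Adjacent (dual N) B B′ ×
        (∃[ x ] Coordinate (∁ B) (∁ B′) x × y ≈ᵀ -ᵀ bar x)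

      Cocircuits : Pred (Vector T n) (c ⊔ ℓ ⊔ q)
      Cocircuits Y =
        Matroid.IsCircuit (dual N) (support Y) ×
        (∀ F a b → a ∈ support Y → b ∈ support Y →
          support Y ⊆ F ∪ ⁅ a ⁆ ∪ ⁅ b ⁆ →
          Matroid.Adjacent (dual N) (F ∪ ⁅ a ⁆) (F ∪ ⁅ b ⁆) →
          ∃[ y ] Coordinate* (F ∪ ⁅ a ⁆) (F ∪ ⁅ b ⁆) y ×
                 Y b ∙ᵀ Y a ⁻¹ᵀ ≈ᵀ -ᵀ y)

{-# OPTIONS --safe #-}

-- Both directions compare an inner product X · Y with the sum appearing in modular
-- elimination. Choose f in the support of the cocircuit Y, and let z, e₁, …, eₖ be the
-- other places where X may meet it. If Xᵢ meets Y inside {f, eᵢ}, Z meets Y inside {f, z},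
-- X(eᵢ) = −Xᵢ(eᵢ), Z(z) = X(z), and Xᵢ ⊥ Y, Z ⊥ Y, then the two-term relations turn X · Y into
-- (X(f) − Z(f) + X₁(f) + ⋯ + Xₖ(f)) times the conjugate of Y(f).
-- From orthogonality to elimination: modularity makes J = ⋃ supports ∖ {z, e₁, …, eₖ}
-- independent, Z is a circuit through z inside J ∪ {z}, and at f ∈ J one takes for Y the
-- fundamental cocircuit of f.
-- From elimination to orthogonality: if X meets Y in two places, X ⊥ Y is the definition of
-- the dual coordinates. Otherwise take f, z, e₁, …, eₖ to be the places where X meets Y, and a
-- basis B meeting Y only in f with X ∖ Y ⊆ B; the Xᵢ are the fundamental circuits of the eᵢ.
module Submission where

open import Level using (Level; _⊔_)
open import Algebra.Bundles using (Group)
open import Algebra.Morphism.Structures using (module MonoidMorphisms)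
import Algebra.Properties.Group as GroupProperties
open import Data.Fin.Base as Fin using (Fin; zero; suc)
open import Data.Fin.Properties as Finₚ using (any?)
open import Data.Fin.Subset
open import Data.Fin.Subset.Properties
open import Data.List.Base as List using (List; []; _∷_; tabulate)
import Data.List.Properties as Listₚ
import Data.List.Relation.Binary.Permutation.Setoid as Permutation
open import Data.List.Relation.Unary.All using (All; []; _∷_)
open import Data.Maybe.Base using (just; nothing; is-just)
open import Data.Maybe.Relation.Binary.Pointwise using (just; nothing)
open import Data.Nat.Base as ℕ using (ℕ; zero; suc; z≤n; s≤s; NonZero)
open import Data.Nat.Induction using (<-wellFounded)
import Data.Nat.Properties as ℕₚ
open import Data.Product.Base using (Σ-syntax; ∃-syntax; _×_; _,_; proj₁; proj₂)
open import Data.Sum.Base using (_⊎_; inj₁; inj₂; [_,_]′)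
open import Data.Vec.Base as Vec using (here; there)
open import Data.Vec.Functional as F using (Vector)
import Data.Vec.Functional.Properties as Fₚ
import Data.Vec.Functional.Relation.Binary.Equality.Setoid as VectorEquality
import Data.Vec.Properties as Vecₚ
open import Function.Base using (_∘_; const)
open import Function.Bundles using (_⇔_; mk⇔)
open import Function.Definitions using (Injective)
open import Induction.WellFounded using (Acc; acc)
open import Relation.Binary.Bundles using (Setoid)
open import Relation.Binary.PropositionalEquality as ≡
  using (_≡_; _≢_; refl; sym; trans; cong; subst)
import Relation.Binary.Reasoning.Setoid as SetoidReasoning
open import Relation.Nullary using (¬_; yes; no; contradiction)
open import Relation.Nullary.Decidable using (_×-dec_; ¬?; decidable-stable)
open import Relation.Unary using (Pred; Decidable; _≐_)
open import Defs

-- Finite subsets and their enumeration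

private
  variable
    n : ℕ
    p q : Subset n
    a b x y v : Fin n

x∈p─q⇒x∉q : x ∈ p ─ q → x ∉ q
x∈p─q⇒x∉q {p = _ Vec.∷ _} {outside Vec.∷ _} here ()
x∈p─q⇒x∉q {p = _ Vec.∷ _} {_ Vec.∷ _} (there x∈) (there x∈q) = x∈p─q⇒x∉q x∈ x∈q

x∈p-y⇒x∈p : v ∈ p - x → v ∈ p
x∈p-y⇒x∈p {p = p} = p─q⊆p p _

x∉p-x : x ∉ p - x
x∉p-x {x = x} x∈ = x∈p─q⇒x∉q x∈ (x∈⁅x⁆ x)

∪-introˡ : v ∈ p → v ∈ p ∪ q
∪-introˡ = x∈p∪q⁺ ∘ inj₁

∪-introʳ : v ∈ q → v ∈ p ∪ q
∪-introʳ = x∈p∪q⁺ ∘ inj₂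

x∈p∪⁅x⁆ : x ∈ p ∪ ⁅ x ⁆
x∈p∪⁅x⁆ {x = x} = ∪-introʳ (x∈⁅x⁆ x)

v∈p∪⁅x⁆⇒v∈p : v ∈ p ∪ ⁅ x ⁆ → v ≢ x → v ∈ p
v∈p∪⁅x⁆⇒v∈p {p = p} v∈ v≢x with x∈p∪q⁻ p ⁅ _ ⁆ v∈
... | inj₁ v∈p = v∈p
... | inj₂ v∈x = contradiction (x∈⁅y⁆⇒x≡y _ v∈x) v≢x

v∈p∪⁅x⁆⇒v≡x : v ∈ p ∪ ⁅ x ⁆ → v ∉ p → v ≡ x
v∈p∪⁅x⁆⇒v≡x {p = p} v∈ v∉p with x∈p∪q⁻ p ⁅ _ ⁆ v∈
... | inj₁ v∈p = contradiction v∈p v∉p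
... | inj₂ v∈x = x∈⁅y⁆⇒x≡y _ v∈x

∪⁅⁆-lub : p ⊆ q → x ∈ q → p ∪ ⁅ x ⁆ ⊆ q
∪⁅⁆-lub {p = p} {x = x} p⊆q x∈q v∈ with x∈p∪q⁻ p ⁅ x ⁆ v∈
... | inj₁ v∈p = p⊆q v∈p
... | inj₂ v∈x = subst (_∈ _) (sym (x∈⁅y⁆⇒x≡y x v∈x)) x∈q

p-x⊆q⇒p⊆q∪⁅x⁆ : p - x ⊆ q → p ⊆ q ∪ ⁅ x ⁆
p-x⊆q⇒p⊆q∪⁅x⁆ {x = x} p-x⊆q {v} v∈p with v Finₚ.≟ x
... | yes refl = x∈p∪⁅x⁆
... | no  v≢x  = ∪-introˡ (p-x⊆q (x∈p∧x≢y⇒x∈p-y v∈p v≢x))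

x∈p⇒p-x∪⁅x⁆≡p : x ∈ p → (p - x) ∪ ⁅ x ⁆ ≡ p
x∈p⇒p-x∪⁅x⁆≡p x∈p = ⊆-antisym (∪⁅⁆-lub x∈p-y⇒x∈p x∈p) (p-x⊆q⇒p⊆q∪⁅x⁆ (λ v∈ → v∈))

∣p∪⁅x⁆─p∪⁅y⁆∣≡1 : x ∉ p → x ≢ y → ∣ (p ∪ ⁅ x ⁆) ─ (p ∪ ⁅ y ⁆) ∣ ≡ 1
∣p∪⁅x⁆─p∪⁅y⁆∣≡1 {x = x} {p} {y} x∉p x≢y = trans (cong ∣_∣ (⊆-antisym to from)) (∣⁅x⁆∣≡1 x)
  where
  to : (p ∪ ⁅ x ⁆) ─ (p ∪ ⁅ y ⁆) ⊆ ⁅ x ⁆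
  to v∈ with x∈p∪q⁻ p ⁅ x ⁆ (p─q⊆p (p ∪ ⁅ x ⁆) _ v∈)
  ... | inj₁ v∈p = contradiction (∪-introˡ v∈p) (x∈p─q⇒x∉q v∈)
  ... | inj₂ v∈x = v∈x
  from : ⁅ x ⁆ ⊆ (p ∪ ⁅ x ⁆) ─ (p ∪ ⁅ y ⁆)
  from v∈ with x∈⁅y⁆⇒x≡y x v∈
  ... | refl = x∈p∧x∉q⇒x∈p─q x∈p∪⁅x⁆ (λ x∈ → x∉p (v∈p∪⁅x⁆⇒v∈p x∈ x≢y))

-- Passing to the dual exchanges the roles of `a` and `b` in a quasi-Plücker coordinate; the new
-- common part is the complement of Fab.
∁p∪⁅x⁆ : b ∉ p ∪ ⁅ a ⁆ → ∁ (p ∪ ⁅ a ⁆) ≡ ∁ (p ∪ ⁅ a ⁆ ∪ ⁅ b ⁆) ∪ ⁅ b ⁆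
∁p∪⁅x⁆ {b = b} {p} {a} b∉ = ⊆-antisym to
  (∪⁅⁆-lub (p⊆q⇒∁p⊇∁q (subst (p ∪ ⁅ a ⁆ ⊆_) (∪-assoc p ⁅ a ⁆ ⁅ b ⁆) ∪-introˡ)) (x∉p⇒x∈∁p b∉))
  where
  to : ∁ (p ∪ ⁅ a ⁆) ⊆ ∁ (p ∪ ⁅ a ⁆ ∪ ⁅ b ⁆) ∪ ⁅ b ⁆
  to {v} v∈ with v Finₚ.≟ b
  ... | yes refl = x∈p∪⁅x⁆
  ... | no  v≢b  = ∪-introˡ (x∉p⇒x∈∁p λ v∈′ → x∈∁p⇒x∉p v∈
        (v∈p∪⁅x⁆⇒v∈p (subst (v ∈_) (sym (∪-assoc p ⁅ a ⁆ ⁅ b ⁆)) v∈′) v≢b))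

⊈⇒∃ : {p q : Subset n} → ¬ (p ⊆ q) → ∃[ x ] x ∈ p × x ∉ q
⊈⇒∃ {p = p} {q} p⊈q with any? (λ x → (x ∈? p) ×-dec ¬? (x ∈? q))
... | yes found = found
... | no  ∄x    = contradiction
  (λ {x} x∈p → decidable-stable (x ∈? q) (λ x∉q → ∄x (x , x∈p , x∉q))) p⊈q

-- Meant for the fundamental circuit `C` of `a` over the complement of Fa and a cocircuit `D` inside
-- Fab, where orthogonality reduces to two terms.
∁-meet : ∀ {C D F : Subset n} {a b} → C ⊆ ∁ (F ∪ ⁅ a ⁆) ∪ ⁅ a ⁆ → D ⊆ F ∪ ⁅ a ⁆ ∪ ⁅ b ⁆ →
         ∀ {v} → v ∈ C → v ∈ D → v ≡ a ⊎ v ≡ b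
∁-meet {F = F} {a} {b} C⊆ D⊆ {v} v∈C v∈D with v Finₚ.≟ a
... | yes v≡a = inj₁ v≡a
... | no  v≢a = inj₂ (v∈p∪⁅x⁆⇒v≡x (subst (v ∈_) (sym (∪-assoc F ⁅ a ⁆ ⁅ b ⁆)) (D⊆ v∈D))
                                  (x∈∁p⇒x∉p (v∈p∪⁅x⁆⇒v∈p (C⊆ v∈C) v≢a)))

∁-involutive : (p : Subset n) → ∁ (∁ p) ≡ p
∁-involutive p = ⊆-antisym (x∉∁p⇒x∈p ∘ x∈∁p⇒x∉p) (x∉p⇒x∈∁p ∘ x∈p⇒x∉∁p)

-- The inclusion of `S` in the union is recorded because `chain-bound` exchanges along a circuit and
-- needs the incoming element to stay inside the union.
∈⋃⁻ : (L : List (Subset n)) {s : Level} {P : Pred (Subset n) s} → All P L →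
      x ∈ ⋃ L → ∃[ S ] P S × S ⊆ ⋃ L × x ∈ S
∈⋃⁻ []      []        x∈ = contradiction x∈ ∉⊥
∈⋃⁻ (S ∷ L) (pS ∷ pL) x∈ with x∈p∪q⁻ S (⋃ L) x∈
... | inj₁ x∈S = S , pS , p⊆p∪q (⋃ L) , x∈S
... | inj₂ x∈L with ∈⋃⁻ L pL x∈L
...   | S′ , pS′ , S′⊆L , x∈S′ = S′ , pS′ , q⊆p∪q S (⋃ L) ∘ S′⊆L , x∈S′

∈⋃-tabulate⁺ : ∀ {m} (S : Vector (Subset n) m) i → S i ⊆ ⋃ (List.tabulate S)
∈⋃-tabulate⁺ S zero    = ∪-introˡ
∈⋃-tabulate⁺ S (suc i) = ∪-introʳ ∘ ∈⋃-tabulate⁺ (S ∘ suc) i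

∈⋃-tabulate⁻ : ∀ {m} (S : Vector (Subset n) m) → x ∈ ⋃ (List.tabulate S) →
               ∃[ i ] x ∈ S i
∈⋃-tabulate⁻ {m = zero}  S x∈ = contradiction x∈ ∉⊥
∈⋃-tabulate⁻ {m = suc m} S x∈ with x∈p∪q⁻ (S zero) _ x∈
... | inj₁ x∈S₀ = zero , x∈S₀
... | inj₂ x∈S′ = let (i , x∈Sᵢ) = ∈⋃-tabulate⁻ (S ∘ suc) x∈S′ in suc i , x∈Sᵢ

-- The index type has exactly `∣ p ∣` elements, so that an enumeration can index a family for
-- elimination and also serve in counting.
record Enumeration (p : Subset n) : Set where
  field
    elem       : Fin ∣ p ∣ → Fin n
    injective  : Injective _≡_ _≡_ elem
    elem∈      : ∀ i → elem i ∈ p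
    surjective : x ∈ p → ∃[ i ] elem i ≡ x

enumerate : (p : Subset n) → Enumeration p
enumerate Vec.[] = record
  { elem = λ () ; injective = λ { {()} } ; elem∈ = λ () ; surjective = λ () }
enumerate (outside Vec.∷ p) = record
  { elem       = suc ∘ elem
  ; injective  = injective ∘ Finₚ.suc-injective
  ; elem∈      = there ∘ elem∈
  ; surjective = λ { (there x∈) → let (i , eq) = surjective x∈ in i , cong suc eq }
  } where open Enumeration (enumerate p)
enumerate (inside Vec.∷ p) = record
  { elem       = λ { zero → zero ; (suc i) → suc (elem i) }
  ; injective  = λ { {zero} {zero} _ → refl
                   ; {suc i} {suc j} eq → cong suc (injective (Finₚ.suc-injective eq)) }
  ; elem∈      = λ { zero → here ; (suc i) → there (elem∈ i) }
  ; surjective = λ { here → zero , refl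
                   ; (there x∈) → let (i , eq) = surjective x∈ in suc i , cong suc eq }
  } where open Enumeration (enumerate p)

-- Choosing for each element of `p` an index that hits it is an injective map.
∣p∣≤m : ∀ {m} (e : Fin m → Fin n) → (∀ {x} → x ∈ p → ∃[ i ] e i ≡ x) → ∣ p ∣ ℕ.≤ m
∣p∣≤m {p = p} e cover = Finₚ.injective⇒≤ {f = proj₁ ∘ cover ∘ elem∈} λ {i} {j} eq →
  injective (trans (sym (proj₂ (cover (elem∈ i))))
                   (trans (cong e eq) (proj₂ (cover (elem∈ j)))))
  where open Enumeration (enumerate p)

-- Bases, independent sets and circuits

module MatroidProperties {n : ℕ} (N : Matroid n) where
  open Matroid N

  abstract
    -- An element of `B′` outside `B` would have to be exchanged for an element of `B` outside `B′`.
    basis-antichain : ∀ {B B′} → IsBasis B → IsBasis B′ → B ⊆ B′ → B′ ⊆ B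
    basis-antichain {B} bB bB′ B⊆B′ {x} x∈B′ with x ∈? B
    ... | yes x∈B = x∈B
    ... | no  x∉B with exchange bB′ bB x∈B′ x∉B
    ...   | y , y∈B , y∉B′ , _ = contradiction (B⊆B′ y∈B) y∉B′

    -- Elements outside `S` are exchanged one at a time for elements of `B₂`, which lie in `S`. This
    -- lowers `∣ B ─ S ∣` and never removes an element of `I`, because `I ⊆ S`.
    basis-between : ∀ {I S B₂} → Independent I → IsBasis B₂ → B₂ ⊆ S → I ⊆ S →
                    ∃[ B ] IsBasis B × I ⊆ B × B ⊆ S
    basis-between {I} {S} {B₂} (B₁ , bB₁ , I⊆B₁) bB₂ B₂⊆S I⊆S =
      go B₁ (<-wellFounded _) bB₁ I⊆B₁
      where
      go : ∀ B → Acc ℕ._<_ ∣ B ─ S ∣ → IsBasis B → I ⊆ B →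
           ∃[ B′ ] IsBasis B′ × I ⊆ B′ × B′ ⊆ S
      go B (acc rs) bB I⊆B with any? (λ z → (z ∈? B) ×-dec ¬? (z ∈? S))
      ... | no ∄z = B , bB , I⊆B ,
                    λ {v} v∈B → decidable-stable (v ∈? S) (λ v∉S → ∄z (v , v∈B , v∉S))
      ... | yes (z , z∈B , z∉S) with exchange bB bB₂ z∈B (z∉S ∘ B₂⊆S)
      ...   | w , w∈B₂ , w∉B , bB′ =
        go B′ (rs (p⊂q⇒∣p∣<∣q∣ (shrinks , z , x∈p∧x∉q⇒x∈p─q z∈B z∉S , z∉B′ ∘ p─q⊆p B′ S))) bB′
           (λ v∈I → ∪-introˡ (x∈p∧x≢y⇒x∈p-y (I⊆B v∈I) (λ { refl → z∉S (I⊆S v∈I) })))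
        where
        B′ : Subset n
        B′ = (B - z) ∪ ⁅ w ⁆
        shrinks : B′ ─ S ⊆ B ─ S
        shrinks v∈ = x∈p∧x∉q⇒x∈p─q
          (x∈p-y⇒x∈p (v∈p∪⁅x⁆⇒v∈p (p─q⊆p B′ S v∈) (λ { refl → x∈p─q⇒x∉q v∈ (B₂⊆S w∈B₂) })))
          (x∈p─q⇒x∉q v∈)
        z∉B′ : z ∉ B′
        z∉B′ z∈ = x∉p-x {p = B} (v∈p∪⁅x⁆⇒v∈p z∈ (λ { refl → w∉B z∈B }))

    independent? : Decidable Independent
    independent? I = anySubset? (λ B → isBasis? B ×-dec (I ⊆? B))

    dependent⇒circuit : ∀ {S} → ¬ Independent S → ∃[ C ] IsCircuit C × C ⊆ S
    dependent⇒circuit {S} = go S (<-wellFounded _)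
      where
      go : ∀ S → Acc ℕ._<_ ∣ S ∣ → ¬ Independent S → ∃[ C ] IsCircuit C × C ⊆ S
      go S (acc rs) dep with any? (λ x → (x ∈? S) ×-dec ¬? (independent? (S - x)))
      ... | yes (x , x∈S , dep′) =
        let (C , cC , C⊆) = go (S - x) (rs (x∈p⇒∣p-x∣<∣p∣ x∈S)) dep′
        in C , cC , x∈p-y⇒x∈p ∘ C⊆
      -- No single deletion leaves a dependent set, and every proper subset of `S` lies in some
      -- `S - x`.
      ... | no ∄x = S , (dep , minimal) , ⊆-refl
        where
        minimal : ∀ S′ → S′ ⊂ S → Independent S′
        minimal S′ (S′⊆S , x , x∈S , x∉S′) with independent? (S - x)
        ... | yes (B , bB , S-x⊆B) = B , bB ,
                λ v∈S′ → S-x⊆B (x∈p∧x≢y⇒x∈p-y (S′⊆S v∈S′) (λ { refl → x∉S′ v∈S′ }))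
        ... | no dep′ = contradiction (x , x∈S , dep′) ∄x

    circuit-nonempty : ∀ {C} → IsCircuit C → Nonempty C
    circuit-nonempty {C} (dep , _) = decidable-stable (nonempty? C)
      λ empty → let (B , bB) = nonempty in
        dep (B , bB , λ v∈ → contradiction (_ , v∈) empty)

    circuit-minus : ∀ {C x} → IsCircuit C → x ∈ C → Independent (C - x)
    circuit-minus (_ , min) x∈C = min _ (x∈p⇒p-x⊂p x∈C)

    fundamental-circuit : ∀ {I a} → Independent I → ¬ Independent (I ∪ ⁅ a ⁆) →
                          ∃[ C ] IsCircuit C × C ⊆ I ∪ ⁅ a ⁆ × a ∈ C
    fundamental-circuit {I} {a} (B , bB , I⊆B) dep =
      let (C , cC , C⊆) = dependent⇒circuit dep
      in C , cC , C⊆ , decidable-stable (a ∈? C) λ a∉C →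
         proj₁ cC (B , bB , λ v∈C → I⊆B (v∈p∪⁅x⁆⇒v∈p (C⊆ v∈C) (λ { refl → a∉C v∈C })))

    basis-∪-dependent : ∀ {B a} → IsBasis B → a ∉ B → ¬ Independent (B ∪ ⁅ a ⁆)
    basis-∪-dependent bB a∉B (B′ , bB′ , B∪a⊆B′) =
      a∉B (basis-antichain bB bB′ (B∪a⊆B′ ∘ ∪-introˡ) (B∪a⊆B′ x∈p∪⁅x⁆))

    -- Extend `C - x` to a basis `B′` inside `(C - x) ∪ B`. It misses `x`, as `C` is dependent, so
    -- exchanging `x` against `B′` brings in an element outside `B`, hence one of `C`.
    circuit-exchange : ∀ {B C x} → IsBasis B → IsCircuit C → x ∈ B → x ∈ C →
                       ∃[ y ] y ∈ C × y ∉ B × IsBasis ((B - x) ∪ ⁅ y ⁆)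
    circuit-exchange {B} {C} {x} bB cC x∈B x∈C =
      let (B′ , bB′ , C-x⊆B′ , B′⊆) =
            basis-between (circuit-minus cC x∈C) bB (q⊆p∪q (C - x) B) (p⊆p∪q B)
          x∉B′ = λ x∈B′ → proj₁ cC (B′ , bB′ , ∪⁅⁆-lub C-x⊆B′ x∈B′ ∘ p-x⊆q⇒p⊆q∪⁅x⁆ (λ v∈ → v∈))
          (y , y∈B′ , y∉B , b) = exchange bB bB′ x∈B x∉B′
      in y , y∈C y∉B (x∈p∪q⁻ (C - x) B (B′⊆ y∈B′)) , y∉B , b
      where
      y∈C : ∀ {y} → y ∉ B → y ∈ C - x ⊎ y ∈ B → y ∈ C
      y∈C y∉B (inj₁ y∈) = x∈p-y⇒x∈p y∈
      y∈C y∉B (inj₂ y∈) = contradiction y∈ y∉B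

    -- The element brought in by `circuit-exchange` lies in `C` but not in `B`, which leaves only
    -- `a`.
    fundamental-circuit-exchange :
      ∀ {B C a x} → IsBasis B → IsCircuit C → C ⊆ B ∪ ⁅ a ⁆ → x ∈ B → x ∈ C →
      IsBasis ((B - x) ∪ ⁅ a ⁆)
    fundamental-circuit-exchange bB cC C⊆ x∈B x∈C with circuit-exchange bB cC x∈B x∈C
    ... | y , y∈C , y∉B , b with v∈p∪⁅x⁆⇒v≡x (C⊆ y∈C) y∉B
    ...   | refl = b

    fundamental-circuit-∋ : ∀ {B C a} → IsBasis B → IsCircuit C → C ⊆ B ∪ ⁅ a ⁆ → a ∈ C
    fundamental-circuit-∋ {C = C} {a} bB cC C⊆ = decidable-stable (a ∈? C) λ a∉C →
      proj₁ cC (_ , bB , λ v∈C → v∈p∪⁅x⁆⇒v∈p (C⊆ v∈C) (λ { refl → a∉C v∈C }))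

    -- If `v` were missing from `C`, exchanging `v` for `a` along `C′` would give a basis containing
    -- `C`. The inclusion is in the form that (C3) asks for.
    fundamental-circuit-unique : ∀ {B C C′ a} → IsBasis B → IsCircuit C → IsCircuit C′ →
      C ⊆ B ∪ ⁅ a ⁆ → C′ ⊆ B ∪ ⁅ a ⁆ → C′ ⊆ C
    fundamental-circuit-unique {B} {C} {C′} {a} bB cC cC′ C⊆ C′⊆ {v} v∈C′ =
      decidable-stable (v ∈? C) λ v∉C →
      let v≢a = λ { refl → v∉C (fundamental-circuit-∋ bB cC C⊆) }
          b = fundamental-circuit-exchange bB cC′ C′⊆ (v∈p∪⁅x⁆⇒v∈p (C′⊆ v∈C′) v≢a) v∈C′
      in proj₁ cC (_ , b , λ w∈C → C⊆swap v∉C w∈C)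
      where
      C⊆swap : v ∉ C → C ⊆ (B - v) ∪ ⁅ a ⁆
      C⊆swap v∉C w∈C with x∈p∪q⁻ B ⁅ a ⁆ (C⊆ w∈C)
      ... | inj₁ w∈B = ∪-introˡ (x∈p∧x≢y⇒x∈p-y w∈B (λ { refl → v∉C w∈C }))
      ... | inj₂ w∈a = ∪-introʳ w∈a

    module _ {s : Level} {𝒮 : Pred (Subset n) s} (circuits : ∀ {S} → 𝒮 S → IsCircuit S) where

      -- If the new element x of a step lies in B, it is exchanged for an element of A outside B
      -- along a circuit, so that ∣ A ─ B ∣ grows at every step.
      chain-bound : ∀ {A h B} → Chain 𝒮 A h → IsBasis B → h ℕ.≤ ∣ A ─ B ∣
      chain-bound bottom bB = z≤n
      chain-bound {B = B} (step {A = A′} ch (L , all , refl) (A′⊆A , x , x∈A , x∉A′)) bB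
        with x ∈? B
      ... | no x∉B = ℕₚ.≤-trans (s≤s (chain-bound ch bB)) (p⊂q⇒∣p∣<∣q∣
              ( (λ v∈ → x∈p∧x∉q⇒x∈p─q (A′⊆A (p─q⊆p A′ B v∈)) (x∈p─q⇒x∉q v∈))
              , x , x∈p∧x∉q⇒x∈p─q x∈A x∉B , x∉A′ ∘ p─q⊆p A′ B))
      ... | yes x∈B with ∈⋃⁻ L all x∈A
      ...   | C , 𝒮C , C⊆A , x∈C with circuit-exchange bB (circuits 𝒮C) x∈B x∈C
      ...     | y , y∈C , y∉B , bB′ =
        ℕₚ.≤-trans (s≤s (chain-bound ch bB′)) (p⊂q⇒∣p∣<∣q∣
          ( (λ v∈ → let v∈A′ = p─q⊆p A′ B′ v∈ in x∈p∧x∉q⇒x∈p─q (A′⊆A v∈A′)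
               λ v∈B → x∈p─q⇒x∉q v∈ (∪-introˡ (x∈p∧x≢y⇒x∈p-y v∈B (λ { refl → x∉A′ v∈A′ }))))
          , y , x∈p∧x∉q⇒x∈p─q (C⊆A y∈C) y∉B , λ y∈ → x∈p─q⇒x∉q y∈ x∈p∪⁅x⁆))
        where
        B′ : Subset n
        B′ = (B - x) ∪ ⁅ y ⁆

-- Chains in the lattice of unions

module _ {s : Level} {𝒮 : Pred (Subset n) s} where

  -- The sets are adjoined from the last to the first. Each step is strict because `e i` lies in
  -- `S i` but neither in `A` nor in a later `S j`. Starting from an arbitrary `A` makes it possible
  -- to place a circuit below the whole family.
  chain-extend : ∀ {m A h} (S : Vector (Subset n) m) (e : Fin m → Fin n) →
    Unions 𝒮 A → Chain 𝒮 A h → (∀ i → 𝒮 (S i)) → (∀ i → e i ∈ S i) → (∀ i → e i ∉ A) →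
    (∀ {i j} → i Fin.< j → e i ∉ S j) →
    Unions 𝒮 (⋃ (List.tabulate S) ∪ A) × Chain 𝒮 (⋃ (List.tabulate S) ∪ A) (m ℕ.+ h)
  chain-extend {m = zero}  {A} S e uA ch 𝒮S e∈ e∉A e∉ =
    subst (Unions 𝒮) eq uA , subst (λ A′ → Chain 𝒮 A′ _) eq ch
    where eq = sym (∪-identityˡ A)
  chain-extend {m = suc m} {A} S e uA ch 𝒮S e∈ e∉A e∉ =
    subst (Unions 𝒮) eq u′ , subst (λ A′ → Chain 𝒮 A′ _) eq
      (step (proj₂ ih) u′ (q⊆p∪q (S zero) A′ , e zero , ∪-introˡ (e∈ zero) , e₀∉A′))
    where
    ih = chain-extend (S ∘ suc) (e ∘ suc) uA ch (𝒮S ∘ suc) (e∈ ∘ suc) (e∉A ∘ suc) (e∉ ∘ s≤s)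
    A′ = ⋃ (List.tabulate (S ∘ suc)) ∪ A
    eq : S zero ∪ A′ ≡ ⋃ (List.tabulate S) ∪ A
    eq = sym (∪-assoc (S zero) _ A)
    u′ : Unions 𝒮 (S zero ∪ A′)
    u′ = let (L , all , ⋃L≡A′) = proj₁ ih in
         S zero ∷ L , 𝒮S zero ∷ all , cong (S zero ∪_) ⋃L≡A′
    e₀∉A′ : e zero ∉ A′
    e₀∉A′ e₀∈ with x∈p∪q⁻ (⋃ (List.tabulate (S ∘ suc))) A e₀∈
    ... | inj₁ e₀∈⋃ = let (j , e₀∈Sⱼ) = ∈⋃-tabulate⁻ (S ∘ suc) e₀∈⋃ in e∉ {j = suc j} (s≤s z≤n) e₀∈Sⱼ
    ... | inj₂ e₀∈A = e∉A zero e₀∈A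

-- Circuits against cocircuits, and adjacent bases

module _ (N : Matroid n) where
  open MatroidProperties N
  private module N = Matroid N
  private module N* = Matroid (dual N)

  abstract
    -- If `x` were the only common element, `C - x` would extend to a basis `B` disjoint from
    -- `D - x`. As `C` is dependent, `B` misses `x` and so all of `D`; the complement of `B` would
    -- then make `D` independent in the dual.
    circuit-cocircuit : ∀ {C D x} → N.IsCircuit C → N*.IsCircuit D → x ∈ C → x ∈ D →
                        ∃[ y ] y ≢ x × y ∈ C × y ∈ D
    circuit-cocircuit {C} {D} {x} cC cD x∈C x∈D
      with any? (λ y → ¬? (y Finₚ.≟ x) ×-dec (y ∈? C) ×-dec (y ∈? D))
    ... | yes found = found
    ... | no ∄y =
      let (B* , bB* , D-x⊆B*) = MatroidProperties.circuit-minus (dual N) cD x∈D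
          (B , bB , C-x⊆B , B⊆) = basis-between (circuit-minus cC x∈C) bB*
            (p⊆q⇒∁p⊇∁q D-x⊆B*)
            (λ v∈C-x → x∉p⇒x∈∁p λ v∈D-x →
              ∄y (_ , (λ { refl → x∉p-x {p = C} v∈C-x }) , x∈p-y⇒x∈p v∈C-x , x∈p-y⇒x∈p v∈D-x))
          x∉B = λ x∈B → proj₁ cC (B , bB , ∪⁅⁆-lub C-x⊆B x∈B ∘ p-x⊆q⇒p⊆q∪⁅x⁆ (λ v∈ → v∈))
      in contradiction (∁ B , subst N.IsBasis (sym (∁-involutive B)) bB , λ {v} v∈D →
           x∉p⇒x∈∁p λ v∈B → x∈∁p⇒x∉p (B⊆ v∈B)
             (x∈p∧x≢y⇒x∈p-y v∈D (λ { refl → x∉B v∈B })))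
         (proj₁ cD)

    -- In the dual, this is the fundamental circuit of `f` over the complement of `B`; it leaves
    -- that complement only at `f`.
    fundamental-cocircuit : ∀ {B f} → N.IsBasis B → f ∈ B →
      ∃[ D ] N*.IsCircuit D × f ∈ D × (∀ {v} → v ∈ D → v ∈ B → v ≡ f)
    fundamental-cocircuit {B} {f} bB f∈B =
      let bB* = subst N.IsBasis (sym (∁-involutive B)) bB
          (D , cD , D⊆ , f∈D) = MatroidProperties.fundamental-circuit (dual N)
            (∁ B , bB* , ⊆-refl)
            (MatroidProperties.basis-∪-dependent (dual N) bB* (x∈p⇒x∉∁p f∈B))
      in D , cD , f∈D , λ v∈D v∈B → v∈p∪⁅x⁆⇒v≡x (D⊆ v∈D) (x∈p⇒x∉∁p v∈B)

module AdjacentBases {n : ℕ} (M : Matroid n) where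
  open Matroid M
  open MatroidProperties M

  abstract
    -- As the difference is not empty, Fa is not contained in Fb, which rules out `a ≡ b` and
    -- `a ∈ F`. If `b ∈ F`, then Fb is contained in Fa, and the antichain property gives the same
    -- contradiction.
    adjacent⁻ : ∀ F a b → Adjacent (F ∪ ⁅ a ⁆) (F ∪ ⁅ b ⁆) → a ≢ b × a ∉ F × b ∉ F
    adjacent⁻ F a b (bFa , bFb , size) = a≢b , a∉F , b∉F
      where
      Fa⊈Fb : ¬ (F ∪ ⁅ a ⁆ ⊆ F ∪ ⁅ b ⁆)
      Fa⊈Fb Fa⊆Fb = contradiction
        (trans (sym size) (trans (cong ∣_∣ (Empty-unique {p = (F ∪ ⁅ a ⁆) ─ (F ∪ ⁅ b ⁆)}
          λ (v , v∈) → x∈p─q⇒x∉q v∈ (Fa⊆Fb (p─q⊆p (F ∪ ⁅ a ⁆) _ v∈)))) (∣⊥∣≡0 n))) λ ()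
      a≢b : a ≢ b
      a≢b refl = Fa⊈Fb (λ v∈ → v∈)
      a∉F : a ∉ F
      a∉F a∈F = Fa⊈Fb (∪⁅⁆-lub ∪-introˡ (∪-introˡ a∈F))
      b∉F : b ∉ F
      b∉F b∈F = Fa⊈Fb (basis-antichain bFb bFa (∪⁅⁆-lub ∪-introˡ (∪-introˡ b∈F)))

    -- The basis `B` is written `(B - a) ∪ ⁅ a ⁆` to give it the shape Fa used by coordinates, with
    -- F equal to `B - a`.
    adjacent⁺ : ∀ {B D a b} → IsBasis B → IsCircuit D → D ⊆ B ∪ ⁅ b ⁆ → a ∈ B → a ∈ D → b ∉ B →
                Adjacent ((B - a) ∪ ⁅ a ⁆) ((B - a) ∪ ⁅ b ⁆)
    adjacent⁺ {B} bB cD D⊆ a∈B a∈D b∉B =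
      subst IsBasis (sym (x∈p⇒p-x∪⁅x⁆≡p a∈B)) bB ,
      fundamental-circuit-exchange bB cD D⊆ a∈B a∈D ,
      ∣p∪⁅x⁆─p∪⁅y⁆∣≡1 (x∉p-x {p = B}) (λ { refl → b∉B a∈B })

-- Arithmetic in a skew tract

module TractProperties {c ℓ p : Level} (𝕋 : SkewTract c ℓ p) where
  open SkewTract 𝕋
  open Group group using () renaming
    ( refl to ≈ᴳ-refl; sym to ≈ᴳ-sym; trans to ≈ᴳ-trans; assoc to ∙ᴳ-assoc
    ; ∙-cong to ∙ᴳ-cong; ∙-congˡ to ∙ᴳ-congˡ; ∙-congʳ to ∙ᴳ-congʳ
    ; identityˡ to ∙ᴳ-identityˡ; identityʳ to ∙ᴳ-identityʳ
    ; inverseˡ to ⁻¹ᴳ-inverseˡ; inverseʳ to ⁻¹ᴳ-inverseʳ )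
  private
    module G = GroupProperties group
    module T = Setoid T-setoid
    module ↭ = Permutation setoidᴳ
  open VectorEquality T-setoid using (_≋_)

  -- An equation with a group element can be matched on to compute in the group, unlike a negated
  -- equation with zero.
  Nonzero : T → Set c
  Nonzero x = ∃[ g ] x ≡ just g

  ∙ᵀ-cong : ∀ {u v x y} → u ≈ᵀ v → x ≈ᵀ y → u ∙ᵀ x ≈ᵀ v ∙ᵀ y
  ∙ᵀ-cong (just u≈v) (just x≈y) = just (∙ᴳ-cong u≈v x≈y)
  ∙ᵀ-cong (just _)   nothing    = nothing
  ∙ᵀ-cong nothing    _          = nothing

  ∙ᵀ-congˡ : ∀ {u x y} → x ≈ᵀ y → u ∙ᵀ x ≈ᵀ u ∙ᵀ y
  ∙ᵀ-congˡ = ∙ᵀ-cong T.refl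

  ∙ᵀ-congʳ : ∀ {u v x} → u ≈ᵀ v → u ∙ᵀ x ≈ᵀ v ∙ᵀ x
  ∙ᵀ-congʳ u≈v = ∙ᵀ-cong u≈v T.refl

  ∙ᵀ-assoc : ∀ x y z → (x ∙ᵀ y) ∙ᵀ z ≈ᵀ x ∙ᵀ (y ∙ᵀ z)
  ∙ᵀ-assoc (just x) (just y) (just z) = just (∙ᴳ-assoc x y z)
  ∙ᵀ-assoc (just _) (just _) nothing  = nothing
  ∙ᵀ-assoc (just _) nothing  _        = nothing
  ∙ᵀ-assoc nothing  _        _        = nothing

  ∙ᵀ-identityˡ : ∀ x → 1ᵀ ∙ᵀ x ≈ᵀ x
  ∙ᵀ-identityˡ (just x) = just (∙ᴳ-identityˡ x)
  ∙ᵀ-identityˡ nothing  = nothing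

  ∙ᵀ-identityʳ : ∀ x → x ∙ᵀ 1ᵀ ≈ᵀ x
  ∙ᵀ-identityʳ (just x) = just (∙ᴳ-identityʳ x)
  ∙ᵀ-identityʳ nothing  = nothing

  ∙ᵀ-zeroʳ : ∀ x → x ∙ᵀ 0ᵀ ≡ 0ᵀ
  ∙ᵀ-zeroʳ (just _) = refl
  ∙ᵀ-zeroʳ nothing  = refl

  ⁻¹ᵀ-inverseˡ : ∀ {x} → Nonzero x → x ⁻¹ᵀ ∙ᵀ x ≈ᵀ 1ᵀ
  ⁻¹ᵀ-inverseˡ (g , refl) = just (⁻¹ᴳ-inverseˡ g)

  ⁻¹ᵀ-inverseʳ : ∀ {x} → Nonzero x → x ∙ᵀ x ⁻¹ᵀ ≈ᵀ 1ᵀ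
  ⁻¹ᵀ-inverseʳ (g , refl) = just (⁻¹ᴳ-inverseʳ g)

  ∙ᵀ-solveʳ : ∀ {x y} → Nonzero x → y ≈ᵀ x ∙ᵀ (x ⁻¹ᵀ ∙ᵀ y)
  ∙ᵀ-solveʳ {x} {y} x≢0 = T.sym (T.trans (T.sym (∙ᵀ-assoc x (x ⁻¹ᵀ) y))
    (T.trans (∙ᵀ-congʳ (⁻¹ᵀ-inverseʳ x≢0)) (∙ᵀ-identityˡ y)))

  ∙ᵀ-cancelˡ : ∀ {u x y} → Nonzero u → u ∙ᵀ x ≈ᵀ u ∙ᵀ y → x ≈ᵀ y
  ∙ᵀ-cancelˡ {x = just _}  {just _}  (g , refl) (just eq) = just (G.∙-cancelˡ g _ _ eq)
  ∙ᵀ-cancelˡ {x = nothing} {nothing} (g , refl) eq        = nothing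

  ¬Null-singleton : ∀ g → ¬ Null (g ∷ [])
  ¬Null-singleton g null =
    ¬Null-1 (Null-resp (↭.prep (⁻¹ᴳ-inverseˡ g) ↭.↭-refl) (Null-left (g ⁻¹ᴳ) null))

  ϵ-unique : ∀ {g} → Null (1ᴳ ∷ g ∷ []) → ϵ ≈ᴳ g
  ϵ-unique = proj₂ (proj₂ negation)

  Null-1ϵ : Null (1ᴳ ∷ ϵ ∷ [])
  Null-1ϵ = proj₁ (proj₂ negation)

  -- The left action of `g ⁻¹ᴳ` makes the first term 1, and then uniqueness of `ϵ` determines the
  -- second.
  Null-pair⇒≈ : ∀ {g h} → Null (g ∷ h ∷ []) → h ≈ᴳ g ∙ᴳ ϵ
  Null-pair⇒≈ {g} {h} null = ≈ᴳ-trans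
    (≈ᴳ-sym (≈ᴳ-trans (≈ᴳ-sym (∙ᴳ-assoc g (g ⁻¹ᴳ) h))
                      (≈ᴳ-trans (∙ᴳ-congʳ (⁻¹ᴳ-inverseʳ g)) (∙ᴳ-identityˡ h))))
    (∙ᴳ-congˡ (≈ᴳ-sym (ϵ-unique (Null-resp
      (↭.prep (⁻¹ᴳ-inverseˡ g) ↭.↭-refl) (Null-left (g ⁻¹ᴳ) null)))))

  Null-ϵ-pair : ∀ g → Null (g ∷ ϵ ∙ᴳ g ∷ [])
  Null-ϵ-pair g = Null-resp (↭.prep (∙ᴳ-identityˡ g) ↭.↭-refl) (Null-right g Null-1ϵ)

  -- The right action of `g` on 1 + ϵ gives g + ϵg, while the left action forces the second term of
  -- a null pair starting with g to be gϵ.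
  ϵ-central : ∀ g → ϵ ∙ᴳ g ≈ᴳ g ∙ᴳ ϵ
  ϵ-central g = Null-pair⇒≈ (Null-ϵ-pair g)

  ϵ∙ϵ≈1 : ϵ ∙ᴳ ϵ ≈ᴳ 1ᴳ
  ϵ∙ϵ≈1 = ≈ᴳ-sym (Null-pair⇒≈ (Null-resp (↭.↭-swap 1ᴳ ϵ ↭.↭-refl) Null-1ϵ))

  -ᵀ-cong : ∀ {x y} → x ≈ᵀ y → -ᵀ x ≈ᵀ -ᵀ y
  -ᵀ-cong = ∙ᵀ-congˡ

  -ᵀ-involutive : ∀ x → -ᵀ (-ᵀ x) ≈ᵀ x
  -ᵀ-involutive (just x) = just (≈ᴳ-trans (≈ᴳ-sym (∙ᴳ-assoc ϵ ϵ x))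
    (≈ᴳ-trans (∙ᴳ-congʳ ϵ∙ϵ≈1) (∙ᴳ-identityˡ x)))
  -ᵀ-involutive nothing  = nothing

  -ᵀ-injective : ∀ {x y} → -ᵀ x ≈ᵀ -ᵀ y → x ≈ᵀ y
  -ᵀ-injective = ∙ᵀ-cancelˡ (ϵ , refl)

  ≈-ᵀ-sym : ∀ {x y} → x ≈ᵀ -ᵀ y → y ≈ᵀ -ᵀ x
  ≈-ᵀ-sym {y = y} x≈-y = T.trans (T.sym (-ᵀ-involutive y)) (-ᵀ-cong (T.sym x≈-y))

  -ᵀ-∙ˡ : ∀ x y → (-ᵀ x) ∙ᵀ y ≈ᵀ -ᵀ (x ∙ᵀ y)
  -ᵀ-∙ˡ = ∙ᵀ-assoc (just ϵ)

  -ᵀ-∙ʳ : ∀ x y → x ∙ᵀ (-ᵀ y) ≈ᵀ -ᵀ (x ∙ᵀ y)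
  -ᵀ-∙ʳ nothing  y = nothing
  -ᵀ-∙ʳ (just x) y = T.trans (T.sym (∙ᵀ-assoc (just x) (just ϵ) y))
    (T.trans (∙ᵀ-congʳ (just (≈ᴳ-sym (ϵ-central x)))) (∙ᵀ-assoc (just ϵ) (just x) y))

  -- A record, since xs and ys cannot be inferred from sum xs ↭ sum ys.
  infix 4 _∼_
  record _∼_ (xs ys : List T) : Set (c ⊔ ℓ) where
    constructor ∼-from
    field sum-↭ : sum xs ↭ sum ys
  open _∼_

  ∼-refl : ∀ {xs} → xs ∼ xs
  ∼-refl = ∼-from ↭.↭-refl

  ∼-trans : ∀ {xs ys zs} → xs ∼ ys → ys ∼ zs → xs ∼ zs
  ∼-trans (∼-from xs↭ys) (∼-from ys↭zs) = ∼-from (↭.↭-trans xs↭ys ys↭zs)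

  ∼-reflexive : ∀ {xs ys} → xs ≡ ys → xs ∼ ys
  ∼-reflexive refl = ∼-refl

  Null-resp-∼ : ∀ {xs ys} → xs ∼ ys → Null (sum xs) → Null (sum ys)
  Null-resp-∼ = Null-resp ∘ sum-↭

  Null-resp-∼˘ : ∀ {xs ys} → xs ∼ ys → Null (sum ys) → Null (sum xs)
  Null-resp-∼˘ = Null-resp ∘ ↭.↭-sym ∘ sum-↭

  ∷-cong : ∀ {x y xs ys} → x ≈ᵀ y → xs ∼ ys → x ∷ xs ∼ y ∷ ys
  ∷-cong (just x≈y) (∼-from xs↭ys) = ∼-from (↭.prep x≈y xs↭ys)
  ∷-cong nothing    (∼-from xs↭ys) = ∼-from xs↭ys

  ∷-swap : ∀ x y xs → x ∷ y ∷ xs ∼ y ∷ x ∷ xs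
  ∷-swap (just x) (just y) xs = ∼-from (↭.↭-swap x y ↭.↭-refl)
  ∷-swap (just x) nothing  xs = ∼-from ↭.↭-refl
  ∷-swap nothing  y        xs = ∼-from ↭.↭-refl

  tabulate-cong : ∀ {m} (g h : Vector T m) → g ≋ h → tabulate g ∼ tabulate h
  tabulate-cong {zero}  g h g≋h = ∼-refl
  tabulate-cong {suc m} g h g≋h =
    ∷-cong (g≋h zero) (tabulate-cong (g ∘ suc) (h ∘ suc) (g≋h ∘ suc))

  tabulate-zero : ∀ {m} (g : Vector T m) → (∀ i → g i ≡ 0ᵀ) → tabulate g ∼ []
  tabulate-zero {zero}  g g≡0 = ∼-refl
  tabulate-zero {suc m} g g≡0 =
    ∼-trans (∷-cong (T.reflexive (g≡0 zero)) (tabulate-zero (g ∘ suc) (g≡0 ∘ suc)))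
            (∼-from ↭.↭-refl)

  -- The extracted entry is overwritten by zero and not deleted: this keeps the index type, and a
  -- zero contributes nothing to the sum.
  tabulate-extract : ∀ {m} (g : Vector T m) a →
    tabulate g ∼ g a ∷ tabulate (F.updateAt g a (const 0ᵀ))
  tabulate-extract g zero    = ∼-from ↭.↭-refl
  tabulate-extract g (suc a) = ∼-trans
    (∷-cong (T.refl {g zero}) (tabulate-extract (g ∘ suc) a))
    (∷-swap (g zero) (g (suc a)) _)

  -- Entries are extracted in the order of `e`; by injectivity, overwriting one of them leaves the
  -- later ones unchanged.
  tabulate-reindex : ∀ {m k} (g : Vector T m) (e : Fin k → Fin m) → Injective _≡_ _≡_ e →
    (∀ x → (∀ i → e i ≢ x) → g x ≡ 0ᵀ) → tabulate g ∼ tabulate (g ∘ e)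
  tabulate-reindex {k = zero}  g e inj zeros = tabulate-zero g (λ x → zeros x λ ())
  tabulate-reindex {k = suc k} g e inj zeros = ∼-trans (tabulate-extract g (e zero))
    (∷-cong (T.refl {g (e zero)}) (∼-trans
      (tabulate-reindex g′ (e ∘ suc) (Finₚ.suc-injective ∘ inj) zeros′)
      (tabulate-cong (g′ ∘ e ∘ suc) (g ∘ e ∘ suc) λ i →
        T.reflexive (Fₚ.updateAt-minimal (e (suc i)) (e zero) g
          (Finₚ.0≢1+n ∘ ≡.sym ∘ inj)))))
    where
    g′ = F.updateAt g (e zero) (const 0ᵀ)
    zeros′ : ∀ x → (∀ i → e (suc i) ≢ x) → g′ x ≡ 0ᵀ
    zeros′ x x∉ with x Finₚ.≟ e zero
    ... | yes refl = Fₚ.updateAt-updates (e zero) g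
    ... | no x≢e₀  = ≡.trans (Fₚ.updateAt-minimal x (e zero) g x≢e₀)
      (zeros x λ { zero eq → x≢e₀ (≡.sym eq) ; (suc i) → x∉ i })

  tabulate-pair : ∀ {m} (g : Vector T m) {a b} → a ≢ b →
    (∀ x → x ≢ a → x ≢ b → g x ≡ 0ᵀ) → tabulate g ∼ g a ∷ g b ∷ []
  tabulate-pair g {a} {b} a≢b zeros = tabulate-reindex g (a F.∷ b F.∷ F.[])
    (λ { {zero} {zero} _ → refl
       ; {zero} {suc zero} eq → contradiction eq a≢b
       ; {suc zero} {zero} eq → contradiction (≡.sym eq) a≢b
       ; {suc zero} {suc zero} _ → refl })
    (λ x x∉ → zeros x (x∉ zero ∘ ≡.sym) (x∉ (suc zero) ∘ ≡.sym))

  -- A single group element is never null, so either both terms vanish or neither does.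
  pair⇒≈-ᵀ : ∀ {x y} → Null (sum (x ∷ y ∷ [])) → y ≈ᵀ -ᵀ x
  pair⇒≈-ᵀ {just x}  {just y}  null =
    just (≈ᴳ-trans (Null-pair⇒≈ null) (≈ᴳ-sym (ϵ-central x)))
  pair⇒≈-ᵀ {just x}  {nothing} null = contradiction null (¬Null-singleton x)
  pair⇒≈-ᵀ {nothing} {just y}  null = contradiction null (¬Null-singleton y)
  pair⇒≈-ᵀ {nothing} {nothing} null = nothing

  ≈-ᵀ⇒pair : ∀ {x y} → y ≈ᵀ -ᵀ x → Null (sum (x ∷ y ∷ []))
  ≈-ᵀ⇒pair {just x}  {just y}  (just y≈ϵx) =
    Null-resp (↭.↭-prep x (↭.prep (≈ᴳ-sym y≈ϵx) ↭.↭-refl)) (Null-ϵ-pair x)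
  ≈-ᵀ⇒pair {nothing} {nothing} _ = Null-0

  sum-map-∙ʳ : ∀ g xs → sum (List.map (_∙ᵀ just g) xs) ≡ List.map (_∙ᴳ g) (sum xs)
  sum-map-∙ʳ g []             = refl
  sum-map-∙ʳ g (just x ∷ xs)  = cong (x ∙ᴳ g ∷_) (sum-map-∙ʳ g xs)
  sum-map-∙ʳ g (nothing ∷ xs) = sum-map-∙ʳ g xs

  Null-sum-∙ʳ⁺ : ∀ g {xs} → Null (sum xs) → Null (sum (List.map (_∙ᵀ just g) xs))
  Null-sum-∙ʳ⁺ g {xs} null = ≡.subst Null (≡.sym (sum-map-∙ʳ g xs)) (Null-right g null)

  Null-sum-∙ʳ⁻ : ∀ g {xs} → Null (sum (List.map (_∙ᵀ just g) xs)) → Null (sum xs)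
  Null-sum-∙ʳ⁻ g {xs} null = Null-resp (cancel (sum xs))
    (Null-right (g ⁻¹ᴳ) (≡.subst Null (sum-map-∙ʳ g xs) null))
    where
    cancel : ∀ s → List.map (_∙ᴳ g ⁻¹ᴳ) (List.map (_∙ᴳ g) s) ↭ s
    cancel []      = ↭.↭-refl
    cancel (x ∷ s) = ↭.prep (≈ᴳ-trans (∙ᴳ-assoc x g (g ⁻¹ᴳ))
      (≈ᴳ-trans (∙ᴳ-congˡ (⁻¹ᴳ-inverseʳ g)) (∙ᴳ-identityʳ x))) (cancel s)

  module _ {n : ℕ} {X : Vector T n} where

    ∈support⁺ : ∀ {x} → Nonzero (X x) → x ∈ support 𝕋 X
    ∈support⁺ {x} (_ , eq) = Vecₚ.lookup⇒[]= x _
      (≡.trans (Vecₚ.lookup∘tabulate (is-just ∘ X) x) (cong is-just eq))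

    ∈support⁻ : ∀ {x} → x ∈ support 𝕋 X → Nonzero (X x)
    ∈support⁻ {x} x∈ with X x
                        | ≡.trans (≡.sym (Vecₚ.lookup∘tabulate (is-just ∘ X) x)) (Vecₚ.[]=⇒lookup x∈)
    ... | just g | _ = g , refl

    ∉support⁻ : ∀ {x} → x ∉ support 𝕋 X → X x ≡ 0ᵀ
    ∉support⁻ {x} x∉ with X x in eq
    ... | just g  = contradiction (∈support⁺ (g , eq)) x∉
    ... | nothing = refl

    ∉support⁺ : ∀ {x} → X x ≈ᵀ 0ᵀ → x ∉ support 𝕋 X
    ∉support⁺ {x} Xx≈0 x∈ with X x | ∈support⁻ x∈
    ∉support⁺ () x∈ | just _ | _

  support-mono : ∀ {n} {X Y : Vector T n} → (∀ x → Nonzero (X x) → Nonzero (Y x)) →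
               support 𝕋 X ⊆ support 𝕋 Y
  support-mono imp x∈ = ∈support⁺ (imp _ (∈support⁻ x∈))

  Nonzero-resp : ∀ {x y} → x ≈ᵀ y → Nonzero x → Nonzero y
  Nonzero-resp (just {y = h} _) _ = h , refl

  Nonzero-∙ : ∀ {x y} → Nonzero x → Nonzero y → Nonzero (x ∙ᵀ y)
  Nonzero-∙ (g , refl) (h , refl) = g ∙ᴳ h , refl

  Nonzero-⁻¹ : ∀ {x} → Nonzero x → Nonzero (x ⁻¹ᵀ)
  Nonzero-⁻¹ (g , refl) = g ⁻¹ᴳ , refl

  Nonzero-∙ˡ⁻ : ∀ {x y} → Nonzero (x ∙ᵀ y) → Nonzero x
  Nonzero-∙ˡ⁻ {just g} _ = g , refl

  Nonzero-∙ʳ⁻ : ∀ {x y} → Nonzero (x ∙ᵀ y) → Nonzero y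
  Nonzero-∙ʳ⁻ {just _} {just h} _ = h , refl

-- The involution and inner products

module InvolutionProperties {c ℓ p : Level} (𝕋 : SkewTract c ℓ p) (inv : Involution 𝕋) where
  open SkewTract 𝕋
  open TractProperties 𝕋
  open Involution inv
  open MonoidMorphisms.IsMonoidHomomorphism isMonoidHomomorphism
    using (homo; ε-homo) renaming (⟦⟧-cong to bar-cong) public
  private
    module T = Setoid T-setoid
    module ↭ = Permutation setoidᴳ
  open VectorEquality T-setoid using (_≋_)

  terms : ∀ {n} → Vector T n → Vector T n → List T
  terms X Y = tabulate λ e → X e ∙ᵀ bar (Y e)

  -- `bar x` is a factor of the bar of `x ∙ᵀ x ⁻¹ᵀ`, which is 1.
  bar-Nonzero : ∀ {x} → Nonzero x → Nonzero (bar x)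
  bar-Nonzero {x} x≢0 = Nonzero-∙ˡ⁻ (Nonzero-resp
    (T.sym (T.trans (T.sym (homo x (x ⁻¹ᵀ))) (T.trans (bar-cong (⁻¹ᵀ-inverseʳ x≢0)) ε-homo)))
    (_ , refl))

  bar-injective : ∀ {x y} → bar x ≈ᵀ bar y → x ≈ᵀ y
  bar-injective {x} {y} eq =
    T.trans (T.sym (bar-involutive x)) (T.trans (bar-cong eq) (bar-involutive y))

  module _ {n : ℕ} {X Y : Vector T n} where

    ·-zeroˡ : ∀ {x} → x ∉ support 𝕋 X → X x ∙ᵀ bar (Y x) ≡ 0ᵀ
    ·-zeroˡ {x} x∉ = cong (_∙ᵀ bar (Y x)) (∉support⁻ {X = X} x∉)

    ·-zeroʳ : ∀ {x} → x ∉ support 𝕋 Y → X x ∙ᵀ bar (Y x) ≡ 0ᵀ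
    ·-zeroʳ {x} x∉ with Y x | ∉support⁻ {X = Y} x∉
    ... | _ | refl with bar nothing | bar-0
    ...   | _ | nothing = ∙ᵀ-zeroʳ (X x)

    ·-zero : ∀ {x} → ¬ (x ∈ support 𝕋 X × x ∈ support 𝕋 Y) → X x ∙ᵀ bar (Y x) ≡ 0ᵀ
    ·-zero {x} ¬both with x ∈? support 𝕋 X
    ... | no  x∉X = ·-zeroˡ x∉X
    ... | yes x∈X = ·-zeroʳ (λ x∈Y → ¬both (x∈X , x∈Y))

    ·-disjoint : (∀ {x} → x ∈ support 𝕋 X → x ∉ support 𝕋 Y) → Null (sum (terms X Y))
    ·-disjoint disj = Null-resp-∼˘
      (tabulate-zero (λ e → X e ∙ᵀ bar (Y e)) (λ x → ·-zero (λ (x∈X , x∈Y) → disj x∈X x∈Y))) Null-0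

    ·-reindex : ∀ {k} (e : Fin k → Fin n) → Injective _≡_ _≡_ e →
      (∀ {x} → x ∈ support 𝕋 X → x ∈ support 𝕋 Y → ∃[ i ] e i ≡ x) →
      terms X Y ∼ tabulate (λ i → X (e i) ∙ᵀ bar (Y (e i)))
    ·-reindex e inj cover = tabulate-reindex _ e inj λ x x∉ →
      ·-zero (λ (x∈X , x∈Y) → let (i , eq) = cover x∈X x∈Y in x∉ i eq)

    ·-pair : ∀ {a b} → a ≢ b →
      (∀ {x} → x ∈ support 𝕋 X → x ∈ support 𝕋 Y → x ≡ a ⊎ x ≡ b) →
      terms X Y ∼ X a ∙ᵀ bar (Y a) ∷ X b ∙ᵀ bar (Y b) ∷ []
    ·-pair {a} {b} a≢b cover = tabulate-pair _ a≢b λ x x≢a x≢b →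
      ·-zero (λ (x∈X , x∈Y) → [ x≢a , x≢b ]′ (cover x∈X x∈Y))

  -- The two lists agree term by term. At `e i` the sign between `X` and `Xs i` cancels the sign in
  -- the two-term relation for `Xs i`; at `z`, where `Z` agrees with `X`, the sign in the relation
  -- for `Z` survives.
  ·-eliminate : ∀ {n k} {X Y Z : Vector T n} {Xs : Vector (Vector T n) k}
    {f z : Fin n} {e : Fin k → Fin n} →
    Injective _≡_ _≡_ (f F.∷ z F.∷ e) →
    (∀ {x} → x ∈ support 𝕋 X → x ∈ support 𝕋 Y → ∃[ i ] (f F.∷ z F.∷ e) i ≡ x) →
    (∀ i {x} → x ∈ support 𝕋 (Xs i) → x ∈ support 𝕋 Y → x ≡ f ⊎ x ≡ e i) →
    (∀ {x} → x ∈ support 𝕋 Z → x ∈ support 𝕋 Y → x ≡ f ⊎ x ≡ z) →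
    (∀ i → Null (sum (terms (Xs i) Y))) → Null (sum (terms Z Y)) →
    (∀ i → X (e i) ≈ᵀ -ᵀ Xs i (e i)) → Z z ≈ᵀ X z →
    terms X Y ∼ List.map (_∙ᵀ bar (Y f)) (X f ∷ (-ᵀ Z f) ∷ tabulate (λ i → Xs i f))
  ·-eliminate {X = X} {Y} {Z} {Xs} {f} {z} {e} inj coverX coverXs coverZ Xs⊥Y Z⊥Y Xe≈ Zz≈ =
    ∼-trans (·-reindex {X = X} {Y} (f F.∷ z F.∷ e) inj coverX)
    (∷-cong (T.refl {X f ∙ᵀ bar (Y f)}) (∷-cong at-z (∼-trans
      (tabulate-cong _ (λ i → Xs i f ∙ᵀ bar (Y f)) at-e)
      (∼-reflexive (≡.sym (Listₚ.map-tabulate (λ i → Xs i f) (_∙ᵀ bar (Y f))))))))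
    where
    open SetoidReasoning T-setoid
    at-z : X z ∙ᵀ bar (Y z) ≈ᵀ -ᵀ Z f ∙ᵀ bar (Y f)
    at-z = begin
      X z ∙ᵀ bar (Y z)    ≈⟨ ∙ᵀ-congʳ Zz≈ ⟨
      Z z ∙ᵀ bar (Y z)    ≈⟨ pair⇒≈-ᵀ (Null-resp-∼
                               (·-pair {X = Z} {Y} (Finₚ.0≢1+n ∘ inj {zero} {suc zero}) coverZ) Z⊥Y) ⟩
      -ᵀ (Z f ∙ᵀ bar (Y f)) ≈⟨ -ᵀ-∙ˡ (Z f) _ ⟨
      -ᵀ Z f ∙ᵀ bar (Y f) ∎
    at-e : ∀ i → X (e i) ∙ᵀ bar (Y (e i)) ≈ᵀ Xs i f ∙ᵀ bar (Y f)
    at-e i = begin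
      X (e i) ∙ᵀ bar (Y (e i))         ≈⟨ ∙ᵀ-congʳ (Xe≈ i) ⟩
      -ᵀ Xs i (e i) ∙ᵀ bar (Y (e i))   ≈⟨ -ᵀ-∙ˡ (Xs i (e i)) _ ⟩
      -ᵀ (Xs i (e i) ∙ᵀ bar (Y (e i))) ≈⟨ ≈-ᵀ-sym (pair⇒≈-ᵀ (Null-resp-∼
        (·-pair {X = Xs i} {Y} (Finₚ.0≢1+n ∘ inj {zero} {suc (suc i)}) (coverXs i)) (Xs⊥Y i))) ⟨
      Xs i f ∙ᵀ bar (Y f) ∎

  -- The hypothesis is the cocircuit condition with the dual coordinate unfolded. The inverse falls
  -- on `xb` because complementation exchanges `a` and `b`.
  coordinate⇒orthogonal : ∀ {xa xb ya yb} → Nonzero xb → Nonzero ya →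
    yb ∙ᵀ ya ⁻¹ᵀ ≈ᵀ -ᵀ (-ᵀ bar (-ᵀ (xb ⁻¹ᵀ ∙ᵀ xa))) → xb ∙ᵀ bar yb ≈ᵀ -ᵀ (xa ∙ᵀ bar ya)
  coordinate⇒orthogonal {xa} {xb} {ya} {yb} xb≢0 ya≢0 eq = begin
    xb ∙ᵀ bar yb                          ≈⟨ ∙ᵀ-congˡ (bar-cong yb≈) ⟩
    xb ∙ᵀ bar (bar (-ᵀ u) ∙ᵀ ya)          ≈⟨ ∙ᵀ-congˡ (homo _ ya) ⟩
    xb ∙ᵀ (bar (bar (-ᵀ u)) ∙ᵀ bar ya)    ≈⟨ ∙ᵀ-congˡ (∙ᵀ-congʳ (bar-involutive _)) ⟩
    xb ∙ᵀ (-ᵀ u ∙ᵀ bar ya)                ≈⟨ ∙ᵀ-assoc xb (-ᵀ u) _ ⟨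
    xb ∙ᵀ -ᵀ u ∙ᵀ bar ya                  ≈⟨ ∙ᵀ-congʳ xb-u ⟩
    -ᵀ xa ∙ᵀ bar ya                       ≈⟨ -ᵀ-∙ˡ xa _ ⟩
    -ᵀ (xa ∙ᵀ bar ya)                     ∎
    where
    open SetoidReasoning T-setoid
    u = xb ⁻¹ᵀ ∙ᵀ xa
    yb≈ : yb ≈ᵀ bar (-ᵀ u) ∙ᵀ ya
    yb≈ = begin
      yb                     ≈⟨ ∙ᵀ-identityʳ yb ⟨
      yb ∙ᵀ 1ᵀ               ≈⟨ ∙ᵀ-congˡ (⁻¹ᵀ-inverseˡ ya≢0) ⟨
      yb ∙ᵀ (ya ⁻¹ᵀ ∙ᵀ ya)   ≈⟨ ∙ᵀ-assoc yb _ ya ⟨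
      yb ∙ᵀ ya ⁻¹ᵀ ∙ᵀ ya     ≈⟨ ∙ᵀ-congʳ (T.trans eq (-ᵀ-involutive _)) ⟩
      bar (-ᵀ u) ∙ᵀ ya       ∎
    xb-u : xb ∙ᵀ -ᵀ u ≈ᵀ -ᵀ xa
    xb-u = begin
      xb ∙ᵀ -ᵀ u               ≈⟨ -ᵀ-∙ʳ xb u ⟩
      -ᵀ (xb ∙ᵀ (xb ⁻¹ᵀ ∙ᵀ xa)) ≈⟨ -ᵀ-cong (∙ᵀ-assoc xb _ xa) ⟨
      -ᵀ (xb ∙ᵀ xb ⁻¹ᵀ ∙ᵀ xa)  ≈⟨ -ᵀ-cong (∙ᵀ-congʳ (⁻¹ᵀ-inverseʳ xb≢0)) ⟩
      -ᵀ (1ᵀ ∙ᵀ xa)            ≈⟨ -ᵀ-cong (∙ᵀ-identityˡ xa) ⟩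
      -ᵀ xa                    ∎

  orthogonal⇒coordinate : ∀ {xa xb ya yb} → Nonzero xb → Nonzero ya →
    xb ∙ᵀ bar yb ≈ᵀ -ᵀ (xa ∙ᵀ bar ya) → yb ∙ᵀ ya ⁻¹ᵀ ≈ᵀ -ᵀ (-ᵀ bar (-ᵀ (xb ⁻¹ᵀ ∙ᵀ xa)))
  orthogonal⇒coordinate {xa} {xb} {ya} {yb} xb≢0 ya≢0 eq =
    T.trans (∙ᵀ-congʳ yb≈) (begin
      y′ ∙ᵀ ya ∙ᵀ ya ⁻¹ᵀ    ≈⟨ ∙ᵀ-assoc y′ ya _ ⟩
      y′ ∙ᵀ (ya ∙ᵀ ya ⁻¹ᵀ)  ≈⟨ ∙ᵀ-congˡ (⁻¹ᵀ-inverseʳ ya≢0) ⟩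
      y′ ∙ᵀ 1ᵀ              ≈⟨ ∙ᵀ-identityʳ y′ ⟩
      y′                    ∎)
    where
    open SetoidReasoning T-setoid
    y′ = -ᵀ (-ᵀ bar (-ᵀ (xb ⁻¹ᵀ ∙ᵀ xa)))
    -- Both yb and y′ ∙ ya solve the orthogonality equation, whose solution is unique.
    yb≈ : yb ≈ᵀ y′ ∙ᵀ ya
    yb≈ = bar-injective (∙ᵀ-cancelˡ xb≢0 (T.trans eq (T.sym
      (coordinate⇒orthogonal {xa} {xb} {ya} xb≢0 ya≢0 (begin
        y′ ∙ᵀ ya ∙ᵀ ya ⁻¹ᵀ    ≈⟨ ∙ᵀ-assoc y′ ya _ ⟩
        y′ ∙ᵀ (ya ∙ᵀ ya ⁻¹ᵀ)  ≈⟨ ∙ᵀ-congˡ (⁻¹ᵀ-inverseʳ ya≢0) ⟩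
        y′ ∙ᵀ 1ᵀ              ≈⟨ ∙ᵀ-identityʳ y′ ⟩
        y′                    ∎)))))

  -- With `xb` invertible, the relation fixes the value at `b` by the value at `a`. The involution
  -- keeps the order of products, so the right factor `α` stays on the right under `bar`.
  relation-determines : ∀ {xa xb ya yb ya′ yb′ α} → Nonzero xb →
    xb ∙ᵀ bar yb ≈ᵀ -ᵀ (xa ∙ᵀ bar ya) → xb ∙ᵀ bar yb′ ≈ᵀ -ᵀ (xa ∙ᵀ bar ya′) →
    ya ≈ᵀ ya′ ∙ᵀ α → yb ≈ᵀ yb′ ∙ᵀ α
  relation-determines {xa} {xb} {ya} {yb} {ya′} {yb′} {α} xb≢0 eq eq′ ya≈ =
    bar-injective (∙ᵀ-cancelˡ xb≢0 (begin
      xb ∙ᵀ bar yb                       ≈⟨ eq ⟩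
      -ᵀ (xa ∙ᵀ bar ya)                  ≈⟨ -ᵀ-cong (∙ᵀ-congˡ (bar-cong ya≈)) ⟩
      -ᵀ (xa ∙ᵀ bar (ya′ ∙ᵀ α))          ≈⟨ -ᵀ-cong (bar-assoc xa ya′) ⟩
      -ᵀ (xa ∙ᵀ bar ya′ ∙ᵀ bar α)        ≈⟨ -ᵀ-∙ˡ (xa ∙ᵀ bar ya′) _ ⟨
      -ᵀ (xa ∙ᵀ bar ya′) ∙ᵀ bar α        ≈⟨ ∙ᵀ-congʳ eq′ ⟨
      xb ∙ᵀ bar yb′ ∙ᵀ bar α             ≈⟨ bar-assoc xb yb′ ⟨
      xb ∙ᵀ bar (yb′ ∙ᵀ α)               ∎))
    where
    open SetoidReasoning T-setoid
    bar-assoc : ∀ x y → x ∙ᵀ bar (y ∙ᵀ α) ≈ᵀ x ∙ᵀ bar y ∙ᵀ bar α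
    bar-assoc x y = T.trans (∙ᵀ-congˡ (homo y α)) (T.sym (∙ᵀ-assoc x _ _))

  relation-scale : ∀ {xa xb xa′ xb′ ya yb} α → xa ≈ᵀ α ∙ᵀ xa′ → xb ≈ᵀ α ∙ᵀ xb′ →
    xb′ ∙ᵀ bar yb ≈ᵀ -ᵀ (xa′ ∙ᵀ bar ya) → xb ∙ᵀ bar yb ≈ᵀ -ᵀ (xa ∙ᵀ bar ya)
  relation-scale {xa} {xb} {xa′} {xb′} {ya} {yb} α xa≈ xb≈ eq = begin
    xb ∙ᵀ bar yb                ≈⟨ ∙ᵀ-congʳ xb≈ ⟩
    α ∙ᵀ xb′ ∙ᵀ bar yb          ≈⟨ ∙ᵀ-assoc α xb′ _ ⟩
    α ∙ᵀ (xb′ ∙ᵀ bar yb)        ≈⟨ ∙ᵀ-congˡ eq ⟩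
    α ∙ᵀ -ᵀ (xa′ ∙ᵀ bar ya)     ≈⟨ -ᵀ-∙ʳ α _ ⟩
    -ᵀ (α ∙ᵀ (xa′ ∙ᵀ bar ya))   ≈⟨ -ᵀ-cong (∙ᵀ-assoc α xa′ _) ⟨
    -ᵀ (α ∙ᵀ xa′ ∙ᵀ bar ya)     ≈⟨ -ᵀ-cong (∙ᵀ-congʳ xa≈) ⟨
    -ᵀ (xa ∙ᵀ bar ya)           ∎
    where open SetoidReasoning T-setoid

-- Signatures and dual quasi-Plücker coordinates

module SignatureProperties {c ℓ p q : Level} (𝕋 : SkewTract c ℓ p) {n : ℕ} (N : Matroid n)
  {𝒞 : Pred (Vector (SkewTract.T 𝕋) n) q} (axioms : LeftAxioms 𝕋 𝒞)
  (supports : Supports 𝕋 𝒞 ≐ Matroid.IsCircuit N) where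

  open SkewTract 𝕋
  open TractProperties 𝕋
  open Matroid N
  open LeftAxioms axioms
  private module T = Setoid T-setoid

  support-circuit : ∀ {X} → 𝒞 X → IsCircuit (support 𝕋 X)
  support-circuit 𝒞X = proj₁ supports (_ , 𝒞X , refl)

  abstract
    representative : ∀ {C x h} → IsCircuit C → x ∈ C → Nonzero h →
                     ∃[ X ] 𝒞 X × support 𝕋 X ≡ C × X x ≈ᵀ h
    representative {C} {x} {h} cC x∈C h≢0 with proj₂ supports cC
    ... | X , 𝒞X , refl with Nonzero-∙ h≢0 (Nonzero-⁻¹ (∈support⁻ {X = X} x∈C))
    -- The scalar acts on the left, so it is `h` times the inverse of `X x`.
    ...   | α , hX⁻¹≡α = _ , C2 𝒞X α , ⊆-antisym
        (support-mono {X = _∙ˡ_ 𝕋 (just α) X} {X} (λ _ → Nonzero-∙ʳ⁻))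
        (support-mono {X = X} {_∙ˡ_ 𝕋 (just α) X} (λ _ → Nonzero-∙ (α , refl))) ,
      (begin
        just α ∙ᵀ X x          ≡⟨ cong (_∙ᵀ X x) hX⁻¹≡α ⟨
        h ∙ᵀ X x ⁻¹ᵀ ∙ᵀ X x    ≈⟨ ∙ᵀ-assoc h _ (X x) ⟩
        h ∙ᵀ (X x ⁻¹ᵀ ∙ᵀ X x)  ≈⟨ ∙ᵀ-congˡ (⁻¹ᵀ-inverseˡ (∈support⁻ {X = X} x∈C)) ⟩
        h ∙ᵀ 1ᵀ                ≈⟨ ∙ᵀ-identityʳ h ⟩
        h                      ∎)
      where open SetoidReasoning T-setoid

module CoordinateProperties {c ℓ p q : Level} (𝕋 : SkewTract c ℓ p) (inv : Involution 𝕋)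
  {n : ℕ} (M : StrongLeftMatroid 𝕋 n q) (N : Matroid n) where

  open SkewTract 𝕋
  open Involution inv
  open TractProperties 𝕋
  open InvolutionProperties 𝕋 inv
  open StrongLeftMatroid M
  private module T = Setoid T-setoid

  abstract
    -- A coordinate brings its own decomposition `F′`, `a′`, `b′` of the complements. Since `F′`
    -- lies in both complements, it contains neither `a` nor `b`, which forces `a′` to be `b` and
    -- `b′` to be `a`.
    coordinate*⁻ : ∀ F a b {y} → b ∉ F ∪ ⁅ a ⁆ → a ∉ F ∪ ⁅ b ⁆ →
      Coordinate* 𝕋 inv M N (F ∪ ⁅ a ⁆) (F ∪ ⁅ b ⁆) y →
      ∃[ X ] Circuits X × a ∈ support 𝕋 X × b ∈ support 𝕋 X ×
             support 𝕋 X ⊆ ∁ (F ∪ ⁅ a ⁆) ∪ ⁅ a ⁆ ×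
             y ≈ᵀ -ᵀ bar (-ᵀ (X b ⁻¹ᵀ ∙ᵀ X a))
    coordinate*⁻ F a b b∉Fa a∉Fb
      (_ , x , (_ , F′ , a′ , b′ , ∁Fa≡ , ∁Fb≡ , X , 𝒞X , a′∈X , b′∈X , X⊆ , x≈) , y≈)
      with v∈p∪⁅x⁆⇒v≡x (subst (b ∈_) ∁Fa≡ (x∉p⇒x∈∁p b∉Fa)) b∉F′
         | v∈p∪⁅x⁆⇒v≡x (subst (a ∈_) ∁Fb≡ (x∉p⇒x∈∁p a∉Fb)) a∉F′
      where
      b∉F′ : b ∉ F′
      b∉F′ b∈F′ = x∈∁p⇒x∉p (subst (b ∈_) (sym ∁Fb≡) (∪-introˡ b∈F′)) x∈p∪⁅x⁆
      a∉F′ : a ∉ F′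
      a∉F′ a∈F′ = x∈∁p⇒x∉p (subst (a ∈_) (sym ∁Fa≡) (∪-introˡ a∈F′)) x∈p∪⁅x⁆
    ... | refl | refl = X , 𝒞X , b′∈X , a′∈X ,
      (λ {v} v∈X → subst (λ S → v ∈ S ∪ ⁅ a ⁆) (sym ∁Fa≡)
        (subst (v ∈_) (sym (∪-assoc F′ ⁅ b ⁆ ⁅ a ⁆)) (X⊆ v∈X))) ,
      T.trans y≈ (-ᵀ-cong (bar-cong x≈))

    coordinate*⁺ : ∀ F a b {X} → Matroid.Adjacent (dual N) (F ∪ ⁅ a ⁆) (F ∪ ⁅ b ⁆) →
      Circuits X → a ∈ support 𝕋 X → b ∈ support 𝕋 X → support 𝕋 X ⊆ ∁ (F ∪ ⁅ a ⁆) ∪ ⁅ a ⁆ →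
      Coordinate* 𝕋 inv M N (F ∪ ⁅ a ⁆) (F ∪ ⁅ b ⁆) (-ᵀ bar (-ᵀ (X b ⁻¹ᵀ ∙ᵀ X a)))
    coordinate*⁺ F a b {X} adj@(bFa , bFb , _) 𝒞X a∈X b∈X X⊆ =
      adj , _ ,
      ( (bFa , bFb , trans (≡.cong₂ (λ S S′ → ∣ S ─ S′ ∣) ∁Fa≡ ∁Fb≡)
                           (∣p∪⁅x⁆─p∪⁅y⁆∣≡1 b∉F′ (a≢b ∘ sym)))
      , F′ , b , a , ∁Fa≡ , ∁Fb≡ , X , 𝒞X , b∈X , a∈X
      , (λ {v} v∈X → subst (v ∈_) (∪-assoc F′ ⁅ b ⁆ ⁅ a ⁆)
                       (subst (λ S → v ∈ S ∪ ⁅ a ⁆) ∁Fa≡ (X⊆ v∈X)))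
      , T.refl) , T.refl
      where
      a≢b : a ≢ b
      a≢b = proj₁ (AdjacentBases.adjacent⁻ (dual N) F a b adj)
      a∉F : a ∉ F
      a∉F = proj₁ (proj₂ (AdjacentBases.adjacent⁻ (dual N) F a b adj))
      b∉F : b ∉ F
      b∉F = proj₂ (proj₂ (AdjacentBases.adjacent⁻ (dual N) F a b adj))
      F′ : Subset n
      F′ = ∁ (F ∪ ⁅ a ⁆ ∪ ⁅ b ⁆)
      ∁Fa≡ : ∁ (F ∪ ⁅ a ⁆) ≡ F′ ∪ ⁅ b ⁆
      ∁Fa≡ = ∁p∪⁅x⁆ (λ b∈ → b∉F (v∈p∪⁅x⁆⇒v∈p b∈ (a≢b ∘ sym)))
      ∁Fb≡ : ∁ (F ∪ ⁅ b ⁆) ≡ F′ ∪ ⁅ a ⁆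
      ∁Fb≡ = trans (∁p∪⁅x⁆ (λ a∈ → a∉F (v∈p∪⁅x⁆⇒v∈p a∈ a≢b)))
                   (cong (λ S → ∁ (F ∪ S) ∪ ⁅ a ⁆) (∪-comm ⁅ b ⁆ ⁅ a ⁆))
      b∉F′ : b ∉ F′
      b∉F′ b∈ = x∈∁p⇒x∉p b∈ (∪-introʳ (∪-introʳ (x∈⁅x⁆ b)))

    -- The cocircuit condition at F = `B - a` speaks of one circuit, the fundamental circuit of `a`
    -- over the complement of `B`. Its two-term relation is transferred to other circuits by
    -- uniqueness and (C3).
    cocircuit-relation : ∀ {Y B a b} → Cocircuits 𝕋 inv M N Y → Matroid.IsBasis (dual N) B →
      a ∈ support 𝕋 Y → a ∈ B → b ∈ support 𝕋 Y → b ∉ B → support 𝕋 Y ⊆ B ∪ ⁅ b ⁆ →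
      ∃[ X ] Circuits X × a ∈ support 𝕋 X × b ∈ support 𝕋 X × support 𝕋 X ⊆ ∁ B ∪ ⁅ a ⁆ ×
             X b ∙ᵀ bar (Y b) ≈ᵀ -ᵀ (X a ∙ᵀ bar (Y a))
    cocircuit-relation {Y} {B} {a} {b} (cY , coordinates) bB a∈Y a∈B b∈Y b∉B Y⊆ =
      let adj = AdjacentBases.adjacent⁺ (dual N) bB cY Y⊆ a∈B a∈Y b∉B
          (y , coord , eq) = coordinates F a b a∈Y b∈Y Y⊆Fab adj
          (X , 𝒞X , a∈X , b∈X , X⊆ , y≈) = coordinate*⁻ F a b
            (b∉B ∘ subst (b ∈_) Fa≡B) (λ a∈ → x∉p-x {p = B} (v∈p∪⁅x⁆⇒v∈p a∈ a≢b)) coord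
      in X , 𝒞X , a∈X , b∈X , (λ v∈ → subst (λ S → _ ∈ ∁ S ∪ ⁅ a ⁆) Fa≡B (X⊆ v∈)) ,
         coordinate⇒orthogonal (∈support⁻ {X = X} b∈X) (∈support⁻ {X = Y} a∈Y)
           (T.trans eq (-ᵀ-cong y≈))
      where
      F : Subset n
      F = B - a
      Fa≡B : F ∪ ⁅ a ⁆ ≡ B
      Fa≡B = x∈p⇒p-x∪⁅x⁆≡p a∈B
      a≢b : a ≢ b
      a≢b refl = b∉B a∈B
      Y⊆Fab : support 𝕋 Y ⊆ F ∪ ⁅ a ⁆ ∪ ⁅ b ⁆
      Y⊆Fab v∈Y = subst (_ ∈_) (∪-assoc F ⁅ a ⁆ ⁅ b ⁆)
        (subst (λ S → _ ∈ S ∪ ⁅ b ⁆) (sym Fa≡B) (Y⊆ v∈Y))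

-- From orthogonality to strong elimination

module Orthogonal⇒Strong {c ℓ p q r : Level} (𝕋 : SkewTract c ℓ p) (inv : Involution 𝕋)
  {n : ℕ} (N : Matroid n)
  {𝒞 : Pred (Vector (SkewTract.T 𝕋) n) q} {𝒟 : Pred (Vector (SkewTract.T 𝕋) n) r}
  (L : LeftSignature 𝕋 N 𝒞) (R : RightSignature 𝕋 (dual N) 𝒟)
  (orth : Orthogonal 𝕋 inv 𝒞 𝒟) where

  open SkewTract 𝕋
  open Involution inv
  open TractProperties 𝕋
  open InvolutionProperties 𝕋 inv
  open Matroid N
  open MatroidProperties N
  open LeftSignature L
  open RightSignature R renaming (supports to supports*)
  open SignatureProperties 𝕋 N leftAxioms supports
  private
    module T = Setoid T-setoid
    module N* = Matroid (dual N)
    module R = RightAxioms rightAxioms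
  open VectorEquality T-setoid using (_≋_)

  module Elimination {k} (Xs : Vector (Vector T n) k) (X : Vector T n)
    (𝒞Xs : ∀ i → 𝒞 (Xs i)) (𝒞X : 𝒞 X)
    (modular : Modular (Supports 𝕋 𝒞) (F.map (support 𝕋) (X F.∷ Xs)))
    {z : Fin n} (z∈X : z ∈ support 𝕋 X) (z∉Xs : ∀ i → z ∉ support 𝕋 (Xs i))
    (e : Fin k → Fin n) (e∈X : ∀ i → e i ∈ support 𝕋 X) (e∈Xs : ∀ i → e i ∈ support 𝕋 (Xs i))
    (e∉Xs : ∀ i j → j ≢ i → e i ∉ support 𝕋 (Xs j))
    (Xe≈ : ∀ i → X (e i) ≈ᵀ -ᵀ Xs i (e i)) where

    S : Vector (Subset n) (suc k)
    S = F.map (support 𝕋) (X F.∷ Xs)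

    -- With `X` first, each `w i` lies in `S i` and in no later set, as `chain-extend` requires; `X`
    -- itself contains every `e i`, so another order would fail.
    w : Fin (suc k) → Fin n
    w = z F.∷ e

    A J : Subset n
    A = ⋃ (tabulate S)
    J = A ─ ⋃ (tabulate (⁅_⁆ ∘ w))

    e-injective : Injective _≡_ _≡_ e
    e-injective {i} {j} eq = decidable-stable (i Finₚ.≟ j) λ i≢j →
      e∉Xs i j (i≢j ∘ sym) (subst (_∈ support 𝕋 (Xs j)) (sym eq) (e∈Xs j))

    w-injective : Injective _≡_ _≡_ w
    w-injective {zero}  {zero}  _  = refl
    w-injective {zero}  {suc j} eq = contradiction (subst (_∈ _) (sym eq) (e∈Xs j)) (z∉Xs j)
    w-injective {suc i} {zero}  eq = contradiction (subst (_∈ _) eq (e∈Xs i)) (z∉Xs i)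
    w-injective {suc i} {suc j} eq = cong suc (e-injective eq)

    J⊆A : J ⊆ A
    J⊆A = p─q⊆p A _

    w∉J : ∀ i → w i ∉ J
    w∉J i w∈J = x∈p─q⇒x∉q w∈J (∈⋃-tabulate⁺ (⁅_⁆ ∘ w) i (x∈⁅x⁆ (w i)))

    A∖J⇒w : ∀ {v} → v ∈ A → v ∉ J → ∃[ i ] w i ≡ v
    A∖J⇒w {v} v∈A v∉J with v ∈? ⋃ (tabulate (⁅_⁆ ∘ w))
    ... | no  v∉W = contradiction (x∈p∧x∉q⇒x∈p─q v∈A v∉W) v∉J
    ... | yes v∈W = let (i , v∈wᵢ) = ∈⋃-tabulate⁻ (⁅_⁆ ∘ w) v∈W in
                    i , sym (x∈⁅y⁆⇒x≡y (w i) v∈wᵢ)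

    X⊆A : support 𝕋 X ⊆ A
    X⊆A = ∈⋃-tabulate⁺ S zero

    Xs⊆A : ∀ i → support 𝕋 (Xs i) ⊆ A
    Xs⊆A i = ∈⋃-tabulate⁺ S (suc i)

    abstract
      -- A circuit inside J could be put at the bottom of the chain of partial unions of S,
      -- making it longer than the height of A.
      J-independent : Independent J
      J-independent = decidable-stable (independent? J) λ dep →
        let (K , cK , K⊆J) = dependent⇒circuit dep
            (v , v∈K)      = circuit-nonempty cK
            uK             = K ∷ [] , proj₂ supports cK ∷ [] , ∪-identityʳ K
            (_ , ch)       = chain-extend S w uK
                               (step bottom uK ((λ v∈⊥ → contradiction v∈⊥ ∉⊥) , v , v∈K , ∉⊥))
                               (proj₁ modular) w∈S (λ i → w∉J i ∘ K⊆J) w∉S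
            A∪K≡A          = ⊆-antisym (λ {x} x∈ → [ (λ x∈A → x∈A) , J⊆A ∘ K⊆J ]′ (x∈p∪q⁻ A K x∈))
                                       (p⊆p∪q K)
            bound          = proj₂ (proj₂ modular) _ (subst (λ A′ → Chain _ A′ _) A∪K≡A ch)
        in ℕₚ.<-irrefl refl (subst (ℕ._≤ suc k) (ℕₚ.+-comm (suc k) 1) bound)
        where
        w∈S : ∀ i → w i ∈ S i
        w∈S zero    = z∈X
        w∈S (suc i) = e∈Xs i
        w∉S : ∀ {i j} → i Fin.< j → w i ∉ S j
        w∉S {zero}  {suc j} _         = z∉Xs j
        w∉S {suc i} {suc j} (s≤s i<j) = e∉Xs i j (Finₚ.<⇒≢ i<j ∘ sym)

      -- Otherwise the fundamental cocircuit of z would meet X in z alone.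
      J∪z-dependent : ¬ Independent (J ∪ ⁅ z ⁆)
      J∪z-dependent (B , bB , J∪z⊆B) =
        let (D , cD , z∈D , D∩B) = fundamental-cocircuit N bB (J∪z⊆B x∈p∪⁅x⁆)
            D∩A = λ {v} (v∈D : v ∈ D) (v∈A : v ∈ A) → A∖J⇒w v∈A λ v∈J →
                    w∉J zero (subst (_∈ J) (D∩B v∈D (J∪z⊆B (∪-introˡ v∈J))) v∈J)
        in meets-X cD z∈D D∩A (D-avoids D∩A cD)
        where
        -- Within `A`, `D` contains only members of `w`. Hence `Xs i` could meet it in `e i` alone,
        -- which a circuit and a cocircuit never do.
        D-avoids : ∀ {D} → (∀ {v} → v ∈ D → v ∈ A → ∃[ i ] w i ≡ v) → N*.IsCircuit D →
                   ∀ i → e i ∉ D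
        D-avoids D∩A cD i e∈D with circuit-cocircuit N (support-circuit (𝒞Xs i)) cD (e∈Xs i) e∈D
        ... | y , y≢e , y∈Xs , y∈D with D∩A y∈D (Xs⊆A i y∈Xs)
        ...   | zero  , refl = z∉Xs i y∈Xs
        ...   | suc j , refl = e∉Xs j i (λ { refl → y≢e refl }) y∈Xs
        meets-X : ∀ {D} → N*.IsCircuit D → z ∈ D →
                  (∀ {v} → v ∈ D → v ∈ A → ∃[ i ] w i ≡ v) → ¬ (∀ i → e i ∉ D)
        meets-X cD z∈D D∩A e∉D with circuit-cocircuit N (support-circuit 𝒞X) cD z∈X z∈D
        ... | y , y≢z , y∈X , y∈D with D∩A y∈D (X⊆A y∈X)
        ...   | zero  , refl = y≢z refl
        ...   | suc j , refl = e∉D j y∈D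

    module _ {Z : Vector T n} (𝒞Z : 𝒞 Z) (Z⊆ : support 𝕋 Z ⊆ J ∪ ⁅ z ⁆) (Zz≈ : Z z ≈ᵀ X z) where

      e∉Z : ∀ i → e i ∉ support 𝕋 Z
      e∉Z i e∈Z = w∉J (suc i) (v∈p∪⁅x⁆⇒v∈p (Z⊆ e∈Z) λ e≡z →
        Finₚ.0≢1+n (sym (w-injective {suc i} {zero} e≡z)))

      Z⊆A : support 𝕋 Z ⊆ A
      Z⊆A = ∪⁅⁆-lub J⊆A (X⊆A z∈X) ∘ Z⊆

      -- The terms are kept as a vector so that `tabulate-pair` can name the two positions that
      -- survive.
      at : Fin n → Vector T (suc (suc k))
      at f = X f F.∷ (-ᵀ Z f) F.∷ λ i → Xs i f

      neg-zero : ∀ {f} → f ∉ support 𝕋 Z → -ᵀ Z f ≡ 0ᵀ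
      neg-zero f∉Z = cong -ᵀ_ (∉support⁻ {X = Z} f∉Z)

      outside-A : ∀ {f} → f ∉ A → Null (sum (tabulate (at f)))
      outside-A {f} f∉A = Null-resp-∼˘ (tabulate-zero (at f) λ
        { zero          → ∉support⁻ {X = X} (f∉A ∘ X⊆A)
        ; (suc zero)    → neg-zero (f∉A ∘ Z⊆A)
        ; (suc (suc i)) → ∉support⁻ {X = Xs i} (f∉A ∘ Xs⊆A i) }) Null-0

      at-z : Null (sum (tabulate (at z)))
      at-z = Null-resp-∼˘ (tabulate-pair (at z) {zero} {suc zero} (λ ()) λ
        { zero 0≢0 _          → contradiction refl 0≢0
        ; (suc zero) _ 1≢1    → contradiction refl 1≢1
        ; (suc (suc i)) _ _   → ∉support⁻ {X = Xs i} (z∉Xs i) })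
        (≈-ᵀ⇒pair (-ᵀ-cong Zz≈))

      -- `Z` and all members of the family other than `X` and `Xs j` vanish at `e j`, where these
      -- two are opposite.
      at-e : ∀ j → Null (sum (tabulate (at (e j))))
      at-e j = Null-resp-∼˘ (tabulate-pair (at (e j)) {zero} {suc (suc j)} (λ ()) λ
        { zero 0≢0 _          → contradiction refl 0≢0
        ; (suc zero) _ _      → neg-zero (e∉Z j)
        ; (suc (suc i)) _ i≢j → ∉support⁻ {X = Xs i} (e∉Xs j i (λ { refl → i≢j refl })) })
        (≈-ᵀ⇒pair (≈-ᵀ-sym (Xe≈ j)))

      -- The fundamental cocircuit of `f` over a basis containing `J` meets `A` only in `f`, `z` and
      -- the `e i`, so `·-eliminate` applies.
      at-J : ∀ {f} → f ∈ J → Null (sum (tabulate (at f)))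
      at-J {f} f∈J
        with J-independent
      ... | B , bB , J⊆B with fundamental-cocircuit N bB (J⊆B f∈J)
      ...   | D , cD , f∈D , D∩B with proj₂ supports* cD
      ...     | Y , 𝒟Y , refl with bar-Nonzero (∈support⁻ {X = Y} f∈D)
      -- The bar of `Y f` is a group element, so it can be cancelled from the null sum on the right.
      ...       | g , Yf≡g = Null-sum-∙ʳ⁻ g {tabulate (at f)}
        (subst (λ t → Null (sum (List.map (_∙ᵀ t) (tabulate (at f))))) Yf≡g
          (Null-resp-∼ (·-eliminate {X = X} {Y} {Z} {Xs} {f} {z} {e} fw-injective
            (λ x∈X x∈Y → A∩Y (X⊆A x∈X) x∈Y)
            (λ i x∈Xs x∈Y → from-Xs i x∈Xs (A∩Y (Xs⊆A i x∈Xs) x∈Y))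
            (λ x∈Z x∈Y → from-Z x∈Z (A∩Y (Z⊆A x∈Z) x∈Y))
            (λ i → orth (𝒞Xs i) 𝒟Y) (orth 𝒞Z 𝒟Y) Xe≈ Zz≈)
          (orth 𝒞X 𝒟Y)))
        where
        f≢w : ∀ i → f ≢ w i
        f≢w i refl = w∉J i f∈J
        fw-injective : Injective _≡_ _≡_ (f F.∷ w)
        fw-injective {zero}  {zero}  _  = refl
        fw-injective {zero}  {suc j} eq = contradiction eq (f≢w j)
        fw-injective {suc i} {zero}  eq = contradiction (sym eq) (f≢w i)
        fw-injective {suc i} {suc j} eq = cong suc (w-injective eq)
        A∩Y : ∀ {v} → v ∈ A → v ∈ support 𝕋 Y → ∃[ i ] (f F.∷ w) i ≡ v
        A∩Y {v} v∈A v∈Y with v ∈? J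
        ... | yes v∈J = zero , sym (D∩B v∈Y (J⊆B v∈J))
        ... | no  v∉J = let (i , eq) = A∖J⇒w v∈A v∉J in suc i , eq
        from-Xs : ∀ i {v} → v ∈ support 𝕋 (Xs i) → (∃[ j ] (f F.∷ w) j ≡ v) → v ≡ f ⊎ v ≡ e i
        from-Xs i v∈Xs (zero        , refl) = inj₁ refl
        from-Xs i v∈Xs (suc zero    , refl) = contradiction v∈Xs (z∉Xs i)
        from-Xs i v∈Xs (suc (suc j) , refl) = inj₂ (decidable-stable (e j Finₚ.≟ e i) λ ej≢ei →
          e∉Xs j i (λ { refl → ej≢ei refl }) v∈Xs)
        from-Z : ∀ {v} → v ∈ support 𝕋 Z → (∃[ j ] (f F.∷ w) j ≡ v) → v ≡ f ⊎ v ≡ z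
        from-Z v∈Z (zero        , refl) = inj₁ refl
        from-Z v∈Z (suc zero    , refl) = inj₂ refl
        from-Z v∈Z (suc (suc j) , refl) = contradiction v∈Z (e∉Z j)

      at-any : ∀ f → Null (sum (tabulate (at f)))
      at-any f with f ∈? A | f ∈? J
      ... | no f∉A  | _       = outside-A f∉A
      ... | yes _   | yes f∈J = at-J f∈J
      ... | yes f∈A | no f∉J with A∖J⇒w f∈A f∉J
      ...   | zero  , refl = at-z
      ...   | suc j , refl = at-e j

    eliminate : Σ[ Z ∈ Vector T n ] 𝒞 Z × (∀ i → Z (e i) ≈ᵀ 0ᵀ) ×
                (∀ f → Null (sum (X f ∷ (-ᵀ Z f) ∷ tabulate (λ i → Xs i f))))
    eliminate with fundamental-circuit J-independent J∪z-dependent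
    ... | C , cC , C⊆ , z∈C with representative cC z∈C (∈support⁻ {X = X} z∈X)
    ...   | Z , 𝒞Z , refl , Zz≈ = Z , 𝒞Z ,
      (λ i → T.reflexive (∉support⁻ {X = Z} (e∉Z 𝒞Z C⊆ Zz≈ i))) , at-any 𝒞Z C⊆ Zz≈

  strong : StrongLeftMatroid 𝕋 n q
  strong = record
    { Circuits   = 𝒞
    ; leftAxioms = leftAxioms
    ; C4′        = λ Xs X 𝒞Xs 𝒞X modular X⊈ e e∈ e∉ Xe≈ →
        let (z , z∈X , z∉) = ⊈⇒∃ X⊈ in
        Elimination.eliminate Xs X 𝒞Xs 𝒞X modular z∈X
          (λ i → z∉ ∘ ∈⋃-tabulate⁺ (support 𝕋 ∘ Xs) i)
          e (λ i → proj₁ (x∈p∩q⁻ _ _ (e∈ i))) (λ i → proj₂ (x∈p∩q⁻ _ _ (e∈ i))) e∉ Xe≈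
    }

  open CoordinateProperties 𝕋 inv strong N

  -- Compare `Y` with the fundamental circuit of `a` over the complement of Fa. They meet inside {a,
  -- b}, and in `b` too because one common element is impossible; orthogonality is then the required
  -- coordinate.
  𝒟⊆Cocircuits : ∀ {Y} → 𝒟 Y → Cocircuits 𝕋 inv strong N Y
  𝒟⊆Cocircuits {Y} 𝒟Y = cY , λ F a b a∈Y b∈Y Y⊆ adj → coordinate F a b a∈Y b∈Y Y⊆ adj
    where
    cY = proj₁ supports* (Y , 𝒟Y , refl)
    coordinate : ∀ F a b → a ∈ support 𝕋 Y → b ∈ support 𝕋 Y →
      support 𝕋 Y ⊆ F ∪ ⁅ a ⁆ ∪ ⁅ b ⁆ → N*.Adjacent (F ∪ ⁅ a ⁆) (F ∪ ⁅ b ⁆) →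
      ∃[ y ] Coordinate* 𝕋 inv strong N (F ∪ ⁅ a ⁆) (F ∪ ⁅ b ⁆) y × Y b ∙ᵀ Y a ⁻¹ᵀ ≈ᵀ -ᵀ y
    coordinate F a b a∈Y b∈Y Y⊆ adj@(bFa , _)
      with AdjacentBases.adjacent⁻ (dual N) F a b adj
    ... | a≢b , _ , _
      with fundamental-circuit (_ , bFa , ⊆-refl) (basis-∪-dependent bFa (x∈p⇒x∉∁p x∈p∪⁅x⁆))
    ... | C , cC , C⊆ , a∈C with proj₂ supports cC
    ... | X , 𝒞X , refl = _ , coordinate*⁺ F a b adj 𝒞X a∈C b∈X C⊆ ,
      orthogonal⇒coordinate (∈support⁻ {X = X} b∈X) (∈support⁻ {X = Y} a∈Y)
        (pair⇒≈-ᵀ (Null-resp-∼ (·-pair {X = X} {Y} a≢b X∩Y) (orth 𝒞X 𝒟Y)))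
      where
      X∩Y : ∀ {v} → v ∈ support 𝕋 X → v ∈ support 𝕋 Y → v ≡ a ⊎ v ≡ b
      X∩Y = ∁-meet {F = F} C⊆ Y⊆
      b∈X : b ∈ support 𝕋 X
      b∈X with circuit-cocircuit N cC cY a∈C a∈Y
      ... | y , y≢a , y∈X , y∈Y with X∩Y y∈X y∈Y
      ...   | inj₁ y≡a  = contradiction y≡a y≢a
      ...   | inj₂ refl = y∈X

  module _ {Y Y′ : Vector T n} (cocY : Cocircuits 𝕋 inv strong N Y) (𝒟Y′ : 𝒟 Y′)
    (supp≡ : support 𝕋 Y′ ≡ support 𝕋 Y) {a : Fin n} (a∈Y : a ∈ support 𝕋 Y)
    (α : T) (Ya≈ : Y a ≈ᵀ Y′ a ∙ᵀ α) where

    -- A circuit meeting the common support exactly in `a` and `b` is orthogonal to `Y′` by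
    -- hypothesis and satisfies the same relation with `Y` by the coordinates, so agreement at `a`
    -- carries over to `b`.
    proportional-on-support : ∀ {b} → b ∈ support 𝕋 Y → b ≢ a → Y b ≈ᵀ Y′ b ∙ᵀ α
    proportional-on-support {b} b∈Y b≢a =
      let (B , bB , Y-b⊆B) = MatroidProperties.circuit-minus (dual N) cY b∈Y
          b∉B = λ b∈B →
            proj₁ cY (B , bB , ∪⁅⁆-lub Y-b⊆B b∈B ∘ p-x⊆q⇒p⊆q∪⁅x⁆ (λ v∈ → v∈))
          (X , 𝒞X , _ , b∈X , X⊆ , XY≈) = cocircuit-relation cocY bB a∈Y
            (Y-b⊆B (x∈p∧x≢y⇒x∈p-y a∈Y (b≢a ∘ sym))) b∈Y b∉B (p-x⊆q⇒p⊆q∪⁅x⁆ Y-b⊆B)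
      in relation-determines (∈support⁻ {X = X} b∈X) XY≈
           (pair⇒≈-ᵀ (Null-resp-∼
             (·-pair {X = X} {Y′} (b≢a ∘ sym) (X∩Y′ {S = support 𝕋 X} Y-b⊆B X⊆)) (orth 𝒞X 𝒟Y′)))
           Ya≈
      where
      cY = proj₁ cocY
      X∩Y′ : ∀ {S B} → support 𝕋 Y - b ⊆ B → S ⊆ ∁ B ∪ ⁅ a ⁆ →
             ∀ {v} → v ∈ S → v ∈ support 𝕋 Y′ → v ≡ a ⊎ v ≡ b
      X∩Y′ Y-b⊆B S⊆ {v} v∈S v∈Y′ with v Finₚ.≟ a | v Finₚ.≟ b
      ... | yes v≡a | _       = inj₁ v≡a
      ... | no  _   | yes v≡b = inj₂ v≡b
      ... | no  v≢a | no v≢b  = contradiction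
        (Y-b⊆B (x∈p∧x≢y⇒x∈p-y (subst (v ∈_) supp≡ v∈Y′) v≢b))
        (x∈∁p⇒x∉p (v∈p∪⁅x⁆⇒v∈p (S⊆ v∈S) v≢a))

    proportional : ∀ b → Y b ≈ᵀ Y′ b ∙ᵀ α
    proportional b with b ∈? support 𝕋 Y | b Finₚ.≟ a
    ... | _       | yes refl = Ya≈
    ... | yes b∈Y | no b≢a   = proportional-on-support b∈Y b≢a
    ... | no b∉Y  | _        = T.reflexive (trans (∉support⁻ {X = Y} b∉Y) (cong (_∙ᵀ α)
            (sym (∉support⁻ {X = Y′} (b∉Y ∘ subst (b ∈_) supp≡)))))

  -- The signature `𝒟` has a member with the support of `Y`. Scaled on the right to agree with `Y`
  -- at one element, it agrees everywhere.
  Cocircuits⊆𝒟 : ∀ {Y} → Cocircuits 𝕋 inv strong N Y → 𝒟 Y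
  Cocircuits⊆𝒟 {Y} cocY =
    let (Y′ , 𝒟Y′ , supp≡) = proj₂ supports* (proj₁ cocY)
        (a , a∈Y)          = MatroidProperties.circuit-nonempty (dual N) (proj₁ cocY)
        Y′a≢0              = ∈support⁻ {X = Y′} (subst (a ∈_) (sym supp≡) a∈Y)
        (α , Y′a⁻¹Ya≡α)    = Nonzero-∙ (Nonzero-⁻¹ Y′a≢0) (∈support⁻ {X = Y} a∈Y)
        Ya≈                = subst (λ t → Y a ≈ᵀ Y′ a ∙ᵀ t) Y′a⁻¹Ya≡α
                               (∙ᵀ-solveʳ Y′a≢0)
    in R.resp (λ b → T.sym (proportional cocY 𝒟Y′ supp≡ a∈Y (just α) Ya≈ b)) (R.C2 𝒟Y′ α)

-- From strong elimination to orthogonality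

module Strong⇒Orthogonal {c ℓ p q : Level} (𝕋 : SkewTract c ℓ p) (inv : Involution 𝕋)
  {n : ℕ} (N : Matroid n) (M : StrongLeftMatroid 𝕋 n q) (underlying : IsUnderlying 𝕋 M N) where

  open SkewTract 𝕋
  open Involution inv
  open TractProperties 𝕋
  open InvolutionProperties 𝕋 inv
  open Matroid N
  open MatroidProperties N
  open StrongLeftMatroid M
  open LeftAxioms leftAxioms
  open SignatureProperties 𝕋 N leftAxioms underlying
  open CoordinateProperties 𝕋 inv M N
  private
    module T = Setoid T-setoid
    module N* = Matroid (dual N)

  module _ {Y : Vector T n} (cocY : Cocircuits 𝕋 inv M N Y) where

    private
      supp* : Subset n
      supp* = support 𝕋 Y

      cY : N*.IsCircuit supp*
      cY = proj₁ cocY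

      coindependent : ∀ {y} → y ∈ supp* → ∃[ B ] IsBasis B × B ⊆ ∁ (supp* - y)
      coindependent y∈Y =
        let (B , bB , Y-y⊆B) = MatroidProperties.circuit-minus (dual N) cY y∈Y
        in ∁ B , bB , p⊆q⇒∁p⊇∁q Y-y⊆B

    -- Some basis `B` contains `X` without `a` and avoids `Y` without `b`. Over it `X` is the
    -- fundamental circuit of `a`, hence a multiple of the circuit given by `cocircuit-relation`.
    relation : ∀ {X a b} → Circuits X → a ≢ b →
      a ∈ support 𝕋 X → a ∈ supp* → b ∈ support 𝕋 X → b ∈ supp* →
      (∀ {v} → v ∈ support 𝕋 X → v ∈ supp* → v ≡ a ⊎ v ≡ b) →
      X b ∙ᵀ bar (Y b) ≈ᵀ -ᵀ (X a ∙ᵀ bar (Y a))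
    relation {X} {a} {b} 𝒞X a≢b a∈X a∈Y b∈X b∈Y X∩Y =
      let (B₂ , bB₂ , B₂⊆) = coindependent b∈Y
          (B , bB , X-a⊆B , B⊆) = basis-between (circuit-minus cX a∈X) bB₂ B₂⊆ X-a⊆
          a∉B  = λ a∈B → proj₁ cX (B , bB , ∪⁅⁆-lub X-a⊆B a∈B ∘ p-x⊆q⇒p⊆q∪⁅x⁆ (λ v∈ → v∈))
          b∈B  = X-a⊆B (x∈p∧x≢y⇒x∈p-y b∈X (a≢b ∘ sym))
          B≡∁∁B = sym (∁-involutive B)
          (X′ , 𝒞X′ , _ , _ , X′⊆ , eq) = cocircuit-relation {b = b} cocY
            (subst IsBasis B≡∁∁B bB) a∈Y (x∉p⇒x∈∁p a∉B) b∈Y (x∈p⇒x∉∁p b∈B)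
            (p-x⊆q⇒p⊆q∪⁅x⁆ λ v∈Y-b → x∉p⇒x∈∁p λ v∈B → x∈∁p⇒x∉p (B⊆ v∈B) v∈Y-b)
          X′⊆X = fundamental-circuit-unique bB cX (support-circuit 𝒞X′) (p-x⊆q⇒p⊆q∪⁅x⁆ X-a⊆B)
            (λ v∈X′ → subst (λ S → _ ∈ S ∪ ⁅ a ⁆) (∁-involutive B) (X′⊆ v∈X′))
          (α , X≈αX′) = C3 𝒞X′ 𝒞X X′⊆X
      in relation-scale (just α) (X≈αX′ a) (X≈αX′ b) eq
      where
      cX : IsCircuit (support 𝕋 X)
      cX = support-circuit 𝒞X
      X-a⊆ : support 𝕋 X - a ⊆ ∁ (supp* - b)
      X-a⊆ v∈X-a = x∉p⇒x∈∁p λ v∈Y-b →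
        [ (λ { refl → x∉p-x {p = support 𝕋 X} v∈X-a }) , (λ { refl → x∉p-x {p = supp*} v∈Y-b }) ]′
        (X∩Y (x∈p-y⇒x∈p v∈X-a) (x∈p-y⇒x∈p v∈Y-b))

    -- A single common element is impossible, so the supports are disjoint or share both `a` and
    -- `b`.
    orthogonal₂ : ∀ {X a b} → Circuits X → a ≢ b →
      (∀ {v} → v ∈ support 𝕋 X → v ∈ supp* → v ≡ a ⊎ v ≡ b) → Null (sum (terms X Y))
    orthogonal₂ {X} {a} {b} 𝒞X a≢b X∩Y with any? (λ v → (v ∈? support 𝕋 X) ×-dec (v ∈? supp*))
    ... | no  ∄v = ·-disjoint {X = X} {Y} (λ v∈X v∈Y → ∄v (_ , v∈X , v∈Y))
    ... | yes (v , v∈X , v∈Y) with circuit-cocircuit N (support-circuit 𝒞X) cY v∈X v∈Y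
    ...   | w , w≢v , w∈X , w∈Y with X∩Y v∈X v∈Y | X∩Y w∈X w∈Y
    ...     | inj₁ refl | inj₁ refl = contradiction refl w≢v
    ...     | inj₂ refl | inj₂ refl = contradiction refl w≢v
    ...     | inj₁ refl | inj₂ refl = Null-resp-∼˘ (·-pair {X = X} {Y} a≢b X∩Y)
      (≈-ᵀ⇒pair (relation 𝒞X a≢b v∈X v∈Y w∈X w∈Y X∩Y))
    ...     | inj₂ refl | inj₁ refl = Null-resp-∼˘ (·-pair {X = X} {Y} a≢b X∩Y)
      (≈-ᵀ⇒pair (relation 𝒞X a≢b w∈X w∈Y v∈X v∈Y X∩Y))

    module ViaElimination {X : Vector T n} (𝒞X : Circuits X) {f z : Fin n}
      (f∈X : f ∈ support 𝕋 X) (f∈Y : f ∈ supp*) (z≢f : z ≢ f)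
      (z∈X : z ∈ support 𝕋 X) (z∈Y : z ∈ supp*) {B : Subset n} (bB : IsBasis B)
      (f∈B : f ∈ B) (X─Y⊆B : support 𝕋 X ─ supp* ⊆ B)
      (B∩Y : ∀ {v} → v ∈ B → v ∈ supp* → v ≡ f) where

      W : Subset n
      W = support 𝕋 X ∩ supp* - f - z

      open Enumeration (enumerate W) renaming (elem to e; injective to e-injective)

      k : ℕ
      k = ∣ W ∣

      e∈ : ∀ i → e i ∈ support 𝕋 X × e i ∈ supp*
      e∈ i = x∈p∩q⁻ _ _ (x∈p-y⇒x∈p {p = support 𝕋 X ∩ supp*} (x∈p-y⇒x∈p (elem∈ i)))

      e≢z : ∀ i → e i ≢ z
      e≢z i eᵢ≡z = x∉p-x {p = support 𝕋 X ∩ supp* - f} (subst (_∈ W) eᵢ≡z (elem∈ i))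

      e≢f : ∀ i → e i ≢ f
      e≢f i eᵢ≡f = x∉p-x {p = support 𝕋 X ∩ supp*} (subst (_∈ _ - f) eᵢ≡f (x∈p-y⇒x∈p (elem∈ i)))

      z∉B : z ∉ B
      z∉B z∈B = z≢f (B∩Y z∈B z∈Y)

      e∉B : ∀ i → e i ∉ B
      e∉B i e∈B = e≢f i (B∩Y e∈B (proj₂ (e∈ i)))

      X∩Y : ∀ {v} → v ∈ support 𝕋 X → v ∈ supp* → ∃[ i ] (f F.∷ z F.∷ e) i ≡ v
      X∩Y {v} v∈X v∈Y with v Finₚ.≟ f | v Finₚ.≟ z
      ... | yes refl | _        = zero , refl
      ... | no _     | yes refl = suc zero , refl
      ... | no v≢f   | no v≢z   =
        let (i , eq) = surjective (x∈p∧x≢y⇒x∈p-y (x∈p∧x≢y⇒x∈p-y (x∈p∩q⁺ (v∈X , v∈Y)) v≢f) v≢z)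
        in suc (suc i) , eq

      fze-injective : Injective _≡_ _≡_ (f F.∷ z F.∷ e)
      fze-injective {zero}        {zero}        _  = refl
      fze-injective {zero}        {suc zero}    eq = contradiction (sym eq) z≢f
      fze-injective {zero}        {suc (suc j)} eq = contradiction (sym eq) (e≢f j)
      fze-injective {suc zero}    {zero}        eq = contradiction eq z≢f
      fze-injective {suc zero}    {suc zero}    _  = refl
      fze-injective {suc zero}    {suc (suc j)} eq = contradiction (sym eq) (e≢z j)
      fze-injective {suc (suc i)} {zero}        eq = contradiction eq (e≢f i)
      fze-injective {suc (suc i)} {suc zero}    eq = contradiction eq (e≢z i)
      fze-injective {suc (suc i)} {suc (suc j)} eq = cong (Fin.suc ∘ Fin.suc) (e-injective eq)

      abstract
        -- The fundamental circuit of `e i` is scaled to meet the sign condition of (C4)′.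
        fundamental : ∀ i → ∃[ X′ ] Circuits X′ × support 𝕋 X′ ⊆ B ∪ ⁅ e i ⁆ ×
                                    e i ∈ support 𝕋 X′ × X (e i) ≈ᵀ -ᵀ X′ (e i)
        fundamental i =
          let (C , cC , C⊆ , e∈C) =
                fundamental-circuit (B , bB , ⊆-refl) (basis-∪-dependent bB (e∉B i))
              (X′ , 𝒞X′ , supp≡ , X′e≈) = representative cC e∈C
                (Nonzero-∙ (ϵ , refl) (∈support⁻ {X = X} (proj₁ (e∈ i))))
          in X′ , 𝒞X′ , (λ v∈ → C⊆ (subst (_ ∈_) supp≡ v∈)) , subst (e i ∈_) (sym supp≡) e∈C ,
             ≈-ᵀ-sym X′e≈

      Xs : Vector (Vector T n) k
      Xs i = proj₁ (fundamental i)

      𝒞Xs : ∀ i → Circuits (Xs i)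
      𝒞Xs i = proj₁ (proj₂ (fundamental i))

      Xs⊆ : ∀ i → support 𝕋 (Xs i) ⊆ B ∪ ⁅ e i ⁆
      Xs⊆ i = proj₁ (proj₂ (proj₂ (fundamental i)))

      e∈Xs : ∀ i → e i ∈ support 𝕋 (Xs i)
      e∈Xs i = proj₁ (proj₂ (proj₂ (proj₂ (fundamental i))))

      Xe≈ : ∀ i → X (e i) ≈ᵀ -ᵀ Xs i (e i)
      Xe≈ i = proj₂ (proj₂ (proj₂ (proj₂ (fundamental i))))

      Xs∩Y : ∀ i {v} → v ∈ support 𝕋 (Xs i) → v ∈ supp* → v ≡ f ⊎ v ≡ e i
      Xs∩Y i {v} v∈Xs v∈Y with v ∈? B
      ... | yes v∈B = inj₁ (B∩Y v∈B v∈Y)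
      ... | no  v∉B = inj₂ (v∈p∪⁅x⁆⇒v≡x (Xs⊆ i v∈Xs) v∉B)

      z∉Xs : ∀ i → z ∉ support 𝕋 (Xs i)
      z∉Xs i z∈Xs = e≢z i (sym (v∈p∪⁅x⁆⇒v≡x (Xs⊆ i z∈Xs) z∉B))

      e∉Xs : ∀ i j → j ≢ i → e i ∉ support 𝕋 (Xs j)
      e∉Xs i j j≢i e∈Xsⱼ = j≢i (sym (e-injective (v∈p∪⁅x⁆⇒v≡x (Xs⊆ j e∈Xsⱼ) (e∉B i))))

      S : Vector (Subset n) (suc k)
      S = F.map (support 𝕋) (X F.∷ Xs)

      A : Subset n
      A = ⋃ (tabulate S)

      𝒮S : ∀ i → Supports 𝕋 Circuits (S i)
      𝒮S zero    = X , 𝒞X , refl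
      𝒮S (suc i) = Xs i , 𝒞Xs i , refl

      abstract
        A─B-cover : ∀ {v} → v ∈ A ─ B → ∃[ i ] (z F.∷ e) i ≡ v
        A─B-cover {v} v∈ = cover (∈⋃-tabulate⁻ S (p─q⊆p A B v∈)) (x∈p─q⇒x∉q v∈)
          where
          cover : (∃[ i ] v ∈ S i) → v ∉ B → ∃[ i ] (z F.∷ e) i ≡ v
          cover (suc i , v∈Xs) v∉B = suc i , sym (v∈p∪⁅x⁆⇒v≡x (Xs⊆ i v∈Xs) v∉B)
          cover (zero , v∈X) v∉B with v ∈? supp*
          ... | no  v∉Y = contradiction (X─Y⊆B (x∈p∧x∉q⇒x∈p─q v∈X v∉Y)) v∉B
          ... | yes v∈Y with X∩Y v∈X v∈Y
          ...   | zero  , refl = contradiction f∈B v∉B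
          ...   | suc i , eq   = i , eq

        -- The partial unions form a chain with `suc k` steps. No chain is longer, since
        -- `chain-bound` limits its length by the number of elements of `A` outside `B`, and these
        -- are among `z` and the `e i`.
        modular : Modular (Supports 𝕋 Circuits) S
        modular = 𝒮S ,
          subst (Chain (Supports 𝕋 Circuits) A) (ℕₚ.+-identityʳ (suc k))
            (subst (λ A′ → Chain (Supports 𝕋 Circuits) A′ (suc k ℕ.+ 0)) (∪-identityʳ A)
              (proj₂ extended)) ,
          λ h ch → ℕₚ.≤-trans (chain-bound (proj₁ underlying) ch bB) (∣p∣≤m (z F.∷ e) A─B-cover)
          where
          w∈S : ∀ i → (z F.∷ e) i ∈ S i
          w∈S zero    = z∈X
          w∈S (suc i) = e∈Xs i
          w∉S : ∀ {i j} → i Fin.< j → (z F.∷ e) i ∉ S j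
          w∉S {zero}  {suc j} _         = z∉Xs j
          w∉S {suc i} {suc j} (s≤s i<j) = e∉Xs i j (Finₚ.<⇒≢ i<j ∘ sym)
          extended : Unions (Supports 𝕋 Circuits) (A ∪ ⊥) ×
                     Chain (Supports 𝕋 Circuits) (A ∪ ⊥) (suc k ℕ.+ 0)
          extended = chain-extend S (z F.∷ e) ([] , [] , refl) bottom 𝒮S w∈S (λ _ → ∉⊥) w∉S

        elimination : Σ[ Z ∈ Vector T n ] Circuits Z × (∀ i → Z (e i) ≈ᵀ 0ᵀ) ×
          (∀ v → Null (sum (X v ∷ (-ᵀ Z v) ∷ tabulate (λ i → Xs i v))))
        elimination = C4′ Xs X 𝒞Xs 𝒞X modular
          (λ X⊆ → let (i , z∈Xs) = ∈⋃-tabulate⁻ (support 𝕋 ∘ Xs) (X⊆ z∈X) in z∉Xs i z∈Xs)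
          e (λ i → x∈p∩q⁺ (proj₁ (e∈ i) , e∈Xs i)) e∉Xs Xe≈

      module _ {Z : Vector T n} (𝒞Z : Circuits Z) (Ze≈0 : ∀ i → Z (e i) ≈ᵀ 0ᵀ)
        (null : ∀ v → Null (sum (X v ∷ (-ᵀ Z v) ∷ tabulate (λ i → Xs i v)))) where

        at : Fin n → Vector T (suc (suc k))
        at v = X v F.∷ (-ᵀ Z v) F.∷ λ i → Xs i v

        -- Where every `Xs i` vanishes, the null sum is just the pair of `X v` and minus `Z v`.
        pair-at : ∀ {v} → (∀ i → v ∉ support 𝕋 (Xs i)) → Z v ≈ᵀ X v
        pair-at {v} v∉Xs = -ᵀ-injective (pair⇒≈-ᵀ (Null-resp-∼
          (tabulate-pair (at v) {zero} {suc zero} (λ ()) λ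
            { zero 0≢0 _        → contradiction refl 0≢0
            ; (suc zero) _ 1≢1  → contradiction refl 1≢1
            ; (suc (suc i)) _ _ → ∉support⁻ {X = Xs i} (v∉Xs i) })
          (null v)))

        -- On `Y` away from `f` and the `e i`, every `Xs i` vanishes, so `Z` agrees with `X`; there
        -- `X` meets `Y` in `z` only.
        Z∩Y : ∀ {v} → v ∈ support 𝕋 Z → v ∈ supp* → v ≡ f ⊎ v ≡ z
        Z∩Y {v} v∈Z v∈Y with v Finₚ.≟ f
        ... | yes v≡f = inj₁ v≡f
        ... | no  v≢f with any? (λ i → e i Finₚ.≟ v)
        ...   | yes (i , refl) = contradiction v∈Z (∉support⁺ {X = Z} (Ze≈0 i))
        ...   | no  ∄i with X∩Y (∈support⁺ {X = X} (Nonzero-resp (pair-at λ i v∈Xs →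
                    [ v≢f , (λ v≡e → ∄i (i , sym v≡e)) ]′ (Xs∩Y i v∈Xs v∈Y))
                    (∈support⁻ {X = Z} v∈Z))) v∈Y
        ...     | zero        , refl = inj₁ refl
        ...     | suc zero    , refl = inj₂ refl
        ...     | suc (suc i) , eq   = contradiction (i , eq) ∄i

        orthogonal-from-elimination : Null (sum (terms X Y))
        orthogonal-from-elimination =
          let (g , Yf≡g) = bar-Nonzero (∈support⁻ {X = Y} f∈Y) in
          Null-resp-∼˘
            (·-eliminate {X = X} {Y} {Z} {Xs} {f} {z} {e} fze-injective X∩Y Xs∩Y Z∩Y
              (λ i → orthogonal₂ (𝒞Xs i) (e≢f i ∘ sym) (Xs∩Y i))
              (orthogonal₂ 𝒞Z (z≢f ∘ sym) Z∩Y) Xe≈ (pair-at z∉Xs))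
            (subst (λ t → Null (sum (List.map (_∙ᵀ t) (tabulate (at f))))) (sym Yf≡g)
              (Null-sum-∙ʳ⁺ g {tabulate (at f)} (null f)))

      orthogonal : Null (sum (terms X Y))
      orthogonal =
        let (_ , 𝒞Z , Ze≈0 , null) = elimination in orthogonal-from-elimination 𝒞Z Ze≈0 null

    circuit-⊥-cocircuit : ∀ {X} → Circuits X → Null (sum (terms X Y))
    circuit-⊥-cocircuit {X} 𝒞X with any? (λ v → (v ∈? support 𝕋 X) ×-dec (v ∈? supp*))
    ... | no  ∄v = ·-disjoint {X = X} {Y} (λ v∈X v∈Y → ∄v (_ , v∈X , v∈Y))
    ... | yes (f , f∈X , f∈Y) =
      let (z , z≢f , z∈X , z∈Y) = circuit-cocircuit N cX cY f∈X f∈Y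
          (B₂ , bB₂ , B₂⊆) = coindependent f∈Y
          (B₁ , bB₁ , X-z⊆B₁) = circuit-minus cX z∈X
          -- The part of `X` outside `Y`, together with `f`, lies in `X` without `z` and is
          -- therefore independent. It avoids `Y` without `f`, so it extends to a basis with the
          -- same property.
          (B , bB , I⊆B , B⊆) = basis-between
            (B₁ , bB₁ , ∪⁅⁆-lub
              (λ v∈ → X-z⊆B₁ (x∈p∧x≢y⇒x∈p-y (p─q⊆p (support 𝕋 X) supp* v∈)
                        (λ { refl → x∈p─q⇒x∉q v∈ z∈Y })))
              (X-z⊆B₁ (x∈p∧x≢y⇒x∈p-y f∈X (z≢f ∘ sym))))
            bB₂ B₂⊆
            (∪⁅⁆-lub (λ v∈ → x∉p⇒x∈∁p (x∈p─q⇒x∉q v∈ ∘ x∈p-y⇒x∈p))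
                     (x∉p⇒x∈∁p (x∉p-x {p = supp*})))
      in ViaElimination.orthogonal 𝒞X f∈X f∈Y z≢f z∈X z∈Y bB (I⊆B x∈p∪⁅x⁆) (I⊆B ∘ ∪-introˡ)
           (λ {v} v∈B v∈Y → decidable-stable (v Finₚ.≟ f) λ v≢f →
             x∈∁p⇒x∉p (B⊆ v∈B) (x∈p∧x≢y⇒x∈p-y v∈Y v≢f))
      where
      cX : IsCircuit (support 𝕋 X)
      cX = support-circuit 𝒞X

theorem3p17 : ∀ {c ℓ p q r : Level} (𝕋 : SkewTract c ℓ p) (inv : Involution 𝕋)
    (n : ℕ) .{{_ : NonZero n}} (N : Matroid n)
    (𝒞 : Pred (Vector (SkewTract.T 𝕋) n) q)
    (𝒟 : Pred (Vector (SkewTract.T 𝕋) n) r) →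
    LeftSignature 𝕋 N 𝒞 → RightSignature 𝕋 (dual N) 𝒟 →
    (Σ[ M ∈ StrongLeftMatroid 𝕋 n q ]
    IsUnderlying 𝕋 M N ×
    𝒞 ≐ StrongLeftMatroid.Circuits M ×
    𝒟 ≐ Cocircuits 𝕋 inv M N)
    ⇔ DualPair 𝕋 inv N 𝒞 𝒟
theorem3p17 {q = q} 𝕋 inv n N 𝒞 𝒟 L R = mk⇔ to from
  where
  to : (Σ[ M ∈ StrongLeftMatroid 𝕋 n q ]
         IsUnderlying 𝕋 M N × 𝒞 ≐ StrongLeftMatroid.Circuits M × 𝒟 ≐ Cocircuits 𝕋 inv M N) →
       DualPair 𝕋 inv N 𝒞 𝒟
  to (M , underlying , (𝒞⊆ , _) , (𝒟⊆ , _)) = record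
    { leftSignature  = L
    ; rightSignature = R
    ; orthogonal     = λ 𝒞X 𝒟Y →
        Strong⇒Orthogonal.circuit-⊥-cocircuit 𝕋 inv N M underlying (𝒟⊆ 𝒟Y) (𝒞⊆ 𝒞X)
    }
  from : DualPair 𝕋 inv N 𝒞 𝒟 →
         Σ[ M ∈ StrongLeftMatroid 𝕋 n q ]
           IsUnderlying 𝕋 M N × 𝒞 ≐ StrongLeftMatroid.Circuits M × 𝒟 ≐ Cocircuits 𝕋 inv M N
  from pair = strong , LeftSignature.supports L , ((λ 𝒞X → 𝒞X) , (λ 𝒞X → 𝒞X)) ,
              (𝒟⊆Cocircuits , Cocircuits⊆𝒟)
    where open Orthogonal⇒Strong 𝕋 inv N L R (λ {X} {Y} → DualPair.orthogonal pair {X} {Y})
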